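{- Let $n,k\ge 1$ and let $A_1,\dots,A_k$ be a system of $k$ mutually unbiased bases of $\mathbb{C}^n$. Then this system can be extended to a system of $k+1$ mutually unbiased bases (i.e. there is an orthonormal basis $A_{k+1}$ of $\mathbb{C}^n$ such that $A_1,\dots,A_{k+1}$ is a system of mutually unbiased bases) if and only if the algebraic variety $Z(M_{k+1}^{\{n\}})$ of the ideal $$M_{k+1}^{\{n\}}=I^{\{n\}}+\sum_{l=1}^{k}J_{l,k+1}^{\{n\}}\subseteq \mathbb{R}[x_{ij},y_{ij}:1\le i,j\le n]$$ has at least one point in $\mathbb{R}^{2n^2}$.
   Context: Two orthonormal bases $\{\mathbf{a}_1,\dots,\mathbf{a}_n\}$ and $\{\mathbf{b}_1,\dots,\mathbf{b}_n\}$ of $\mathbb{C}^n$ are mutually unbiased if $|\langle \mathbf{a}_i,\mathbf{b}_j\rangle|=\frac{1}{\sqrt n}$ for all $1\le i,j\le n$. A system of $k$ mutually unbiased bases (MUBs) is a list of $k$ orthonormal bases of $\mathbb{C}^n$ that are pairwise mutually unbiased. Write $A_l=\{\mathbf{a}_j^{(l)}:1\le j\le n\}$ with $\mathbf{a}_j^{(l)}=(a_{1j}^{(l)},\dots,a_{nj}^{(l)})^t$ and $a_{ij}^{(l)}=b_{ij}^{(l)}+i\,c_{ij}^{(l)}$, where $b_{ij}^{(l)},c_{ij}^{(l)}\in\mathbb{R}$ (the factor $i$ is the imaginary unit). Let $S=\mathbb{R}[x_{ij},y_{ij}:1\le i,j\le n]$. Define the ideals of $S$ $$I^{\{n\}}=\Big(\sum_{i=1}^{n}(x_{ij}x_{ik}+y_{ij}y_{ik}),\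 \sum_{i=1}^{n}(x_{ik}y_{ij}-x_{ij}y_{ik})\ :\ 1\le j\ne k\le n\Big),$$ and, for $1\le l\le k$, $$J_{l,k+1}^{\{n\}}=\Big(\Big\{\sum_{i=1}^{n}(x_{ij}b_{iq}^{(l)}+y_{ij}c_{iq}^{(l)})\Big\}^2+\Big\{\sum_{i=1}^{n}(b_{iq}^{(l)}y_{ij}-x_{ij}c_{iq}^{(l)})\Big\}^2-\frac1n\ :\ 1\le j,q\le n\Big).$$ For a subset $\Phi\subseteq S$, $Z(\Phi)$ denotes the set of all common zeros of $\Phi$ with coordinates in the algebraic closure $\mathbb{C}$ of $\mathbb{R}$. -}

module Defs where

open import Algebra.Bundles using (CommutativeRing)
import Algebra.Properties.CommutativeMonoid.Sum as Sum
import Algebra.Properties.Semiring.Exp as Exp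
open import Algebra.Structures using (IsCommutativeRing)
open import Data.Fin.Base using (Fin)
open import Data.Integer.Base as ℤ using (+_; -[1+_])
import Data.Integer.Properties as ℤ
open import Data.Nat.Base as ℕ using (ℕ; zero; suc)
import Data.Nat.Properties as ℕ
open import Data.Product.Base using (_×_; _,_; ∃; proj₁; proj₂)
open import Data.Rational as ℚ using (ℚ; 0ℚ; 1ℚ; ½; mkℚ)
import Data.Rational.Properties as ℚ
open import Data.Rational.Solver using (module +-*-Solver)
import Data.Rational.Unnormalised as ℚᵘ
import Data.Rational.Unnormalised.Properties as ℚᵘ
open import Data.Sum.Base using (inj₁; inj₂)
open import Data.Vec.Functional using (Vector)
open import Function.Base using (_∘_)
open import Level as Level using (Level; 0ℓ)
open import Relation.Binary.PropositionalEquality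
  using (_≡_; _≢_; refl; sym; trans; cong; cong₂; subst; subst₂)
open import Relation.Binary.Structures using (IsEquivalence)
open import Relation.Nullary.Decidable using (yes; no)
open import Relation.Nullary.Negation using (contradiction)
open import Relation.Unary using (Pred; _∈_)

module ℚ-Lemmas where
  open import Data.Rational

  *-mono-≤ : ∀ {a b c d} → 0ℚ ≤ a → 0ℚ ≤ d → a ≤ b → c ≤ d → a * c ≤ b * d
  *-mono-≤ {a} {b} {c} {d} 0≤a 0≤d a≤b c≤d = ℚ.≤-trans
    (ℚ.*-monoˡ-≤-nonNeg a {{nonNegative 0≤a}} c≤d)
    (ℚ.*-monoʳ-≤-nonNeg d {{nonNegative 0≤d}} a≤b)

  0≤* : ∀ {a b} → 0ℚ ≤ a → 0ℚ ≤ b → 0ℚ ≤ a * b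
  0≤* {a} {b} 0≤a 0≤b = ℚ.nonNegative⁻¹ (a * b)
    {{ℚ.nonNeg*nonNeg⇒nonNeg a {{nonNegative 0≤a}} b {{nonNegative 0≤b}}}}

  0<* : ∀ {a b} → 0ℚ < a → 0ℚ < b → 0ℚ < a * b
  0<* {a} {b} 0<a 0<b = ℚ.positive⁻¹ (a * b)
    {{ℚ.pos*pos⇒pos a {{positive 0<a}} b {{positive 0<b}}}}

  0<½* : ∀ {ε} → 0ℚ < ε → 0ℚ < ½ * ε
  0<½* = 0<* (ℚ.positive⁻¹ ½)

  ½+½ : ∀ ε → ½ * ε + ½ * ε ≡ ε
  ½+½ = solve 1 (λ e → con ½ :* e :+ con ½ :* e := e) refl
    where open +-*-Solver

  quotient : ∀ ε C → 0ℚ < ε → 0ℚ < C → ∃ λ η → 0ℚ < η × C * η ≡ ε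
  quotient ε C 0<ε 0<C = 1/ C * ε , 0<* 0<1/C 0<ε ,
    trans (sym (ℚ.*-assoc C (1/ C) ε))
      (trans (cong (_* ε) (ℚ.*-inverseʳ C)) (ℚ.*-identityˡ ε))
    where
    instance
      C-pos = positive 0<C
      C-nonZero = ℚ.pos⇒nonZero C
    0<1/C = ℚ.positive⁻¹ (1/ C) {{ℚ.1/pos⇒pos C}}

  p≤∣p∣ : ∀ p → p ≤ ∣ p ∣
  p≤∣p∣ p with ℚ.≤-total 0ℚ p
  ... | inj₁ 0≤p = ℚ.≤-reflexive (sym (ℚ.0≤p⇒∣p∣≡p 0≤p))
  ... | inj₂ p≤0 = ℚ.≤-trans p≤0 (ℚ.0≤∣p∣ p)

  ∣-∣-sym : ∀ p q → ∣ p - q ∣ ≡ ∣ q - p ∣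
  ∣-∣-sym p q = trans (sym (ℚ.∣-p∣≡∣p∣ (p - q))) (cong ∣_∣
    (solve 2 (λ p q → :- (p :- q) := q :- p) refl p q))
    where open +-*-Solver

  ∣-∣-bound : ∀ {p b} → p ≤ b → - p ≤ b → ∣ p ∣ ≤ b
  ∣-∣-bound {p} p≤b -p≤b with ℚ.∣p∣≡p∨∣p∣≡-p p
  ... | inj₁ eq = subst (_≤ _) (sym eq) p≤b
  ... | inj₂ eq = subst (_≤ _) (sym eq) -p≤b

  ≤-shift : ∀ {p q r} → p ≤ q + r → p - q ≤ r
  ≤-shift {p} {q} {r} h = subst (p - q ≤_)
    (solve 2 (λ q r → q :+ r :- q := r) refl q r) (ℚ.+-monoˡ-≤ (- q) h)
    where open +-*-Solver

  ≤-unshift : ∀ {p q r} → p - q ≤ r → p ≤ q + r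
  ≤-unshift {p} {q} {r} h = subst (_≤ q + r)
    (solve 2 (λ p q → q :+ (p :- q) := p) refl p q) (ℚ.+-monoʳ-≤ q h)
    where open +-*-Solver

  square-cancel : ∀ {a b} → 0ℚ ≤ b → a * a ≤ b * b → a ≤ b
  square-cancel {a} {b} 0≤b h with a ℚ.≤? b
  ... | yes a≤b = a≤b
  ... | no  a≰b = contradiction (ℚ.≤-<-trans h (ℚ.≤-<-trans
          (ℚ.*-monoˡ-≤-nonNeg b {{nonNegative 0≤b}} (ℚ.<⇒≤ b<a))
          (ℚ.*-monoˡ-<-pos a {{positive (ℚ.≤-<-trans 0≤b b<a)}} b<a))) (ℚ.<-irrefl refl)
    where b<a = ℚ.≰⇒> a≰b

  fromℕ : ℕ → ℚ
  fromℕ n = + n / 1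

  fromℕ-suc : ∀ n → fromℕ (suc n) ≡ 1ℚ + fromℕ n
  fromℕ-suc n = ℚ.toℚᵘ-injective (ℚᵘ.≃-trans (ℚ.toℚᵘ-fromℚᵘ (ℚᵘ.mkℚᵘ (+ suc n) 0))
    (ℚᵘ.≃-sym (ℚᵘ.≃-trans (ℚ.toℚᵘ-homo-+ 1ℚ (fromℕ n))
      (ℚᵘ.≃-trans (ℚᵘ.+-congʳ (toℚᵘ 1ℚ) (ℚ.toℚᵘ-fromℚᵘ (ℚᵘ.mkℚᵘ (+ n) 0)))
        (ℚᵘ.*≡* (cong (λ z → (+ 1 ℤ.+ z) ℤ.* + 1) (ℤ.*-identityʳ (+ n))))))))

  archimedean : ∀ q → ∃ λ N → q ≤ fromℕ N
  archimedean q = ℤ.∣ ↥ q ∣ , ℚ.toℚᵘ-cancel-≤ (ℚᵘ.≤-respʳ-≃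
    (ℚᵘ.≃-sym (ℚ.toℚᵘ-fromℚᵘ (ℚᵘ.mkℚᵘ (+ ℤ.∣ ↥ q ∣) 0))) (bound q))
    where
    bound : ∀ q → toℚᵘ q ℚᵘ.≤ ℚᵘ.mkℚᵘ (+ ℤ.∣ ↥ q ∣) 0
    bound (mkℚ (+ n) d-1 _) = ℚᵘ.*≤* (subst₂ ℤ._≤_ (sym (ℤ.*-identityʳ (+ n)))
      (ℤ.pos-* n (suc d-1)) (ℤ.+≤+ (ℕ.m≤m*n n (suc d-1))))
    bound (mkℚ -[1+ n ] d-1 _) = ℚᵘ.*≤* ℤ.-≤+

  0≤1 : 0ℚ ≤ 1ℚ
  0≤1 = ℚ.nonNegative⁻¹ 1ℚ

  0≤½ : 0ℚ ≤ ½
  0≤½ = ℚ.nonNegative⁻¹ ½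

  fromℕ-nonNeg : ∀ n → 0ℚ ≤ fromℕ n
  fromℕ-nonNeg zero    = ℚ.≤-refl
  fromℕ-nonNeg (suc n) = subst (0ℚ ≤_) (sym (fromℕ-suc n)) (ℚ.+-mono-≤ 0≤1 (fromℕ-nonNeg n))

  fromℕ-mono : ∀ {m n} → m ℕ.≤ n → fromℕ m ≤ fromℕ n
  fromℕ-mono {n = n} ℕ.z≤n = fromℕ-nonNeg n
  fromℕ-mono (ℕ.s≤s {m} {n} m≤n) = subst₂ _≤_ (sym (fromℕ-suc m)) (sym (fromℕ-suc n))
    (ℚ.+-monoʳ-≤ 1ℚ (fromℕ-mono m≤n))

  ½^_ : ℕ → ℚ
  ½^ zero  = 1ℚ
  ½^ suc n = ½ * ½^ n

  ½^-nonNeg : ∀ n → 0ℚ ≤ ½^ n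
  ½^-nonNeg zero    = 0≤1
  ½^-nonNeg (suc n) = 0≤* 0≤½ (½^-nonNeg n)

  ½^-≤1 : ∀ n → ½^ n ≤ 1ℚ
  ½^-≤1 zero    = ℚ.≤-refl
  ½^-≤1 (suc n) = *-mono-≤ {½} {1ℚ} {½^ n} {1ℚ} 0≤½ 0≤1 ½≤1 (½^-≤1 n)
    where
    ½≤1 : ½ ≤ 1ℚ
    ½≤1 = *≤* (ℤ.+≤+ (ℕ.s≤s ℕ.z≤n))

  fromℕ*½^-≤1 : ∀ n → fromℕ n * ½^ n ≤ 1ℚ
  fromℕ*½^-≤1 zero    = subst (_≤ 1ℚ) (sym (ℚ.*-zeroˡ 1ℚ)) 0≤1
  fromℕ*½^-≤1 (suc n) = begin
    fromℕ (suc n) * (½ * ½^ n)            ≡⟨ cong (_* (½ * ½^ n)) (fromℕ-suc n) ⟩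
    (1ℚ + fromℕ n) * (½ * ½^ n)           ≡⟨ solve 2 (λ N h → (con 1ℚ :+ N) :* (con ½ :* h)
                                               := con ½ :* h :+ con ½ :* (N :* h)) refl (fromℕ n) (½^ n) ⟩
    ½ * ½^ n + ½ * (fromℕ n * ½^ n)       ≤⟨ ℚ.+-mono-≤ (ℚ.*-monoˡ-≤-nonNeg ½ (½^-≤1 n))
                                               (ℚ.*-monoˡ-≤-nonNeg ½ (fromℕ*½^-≤1 n)) ⟩
    ½ * 1ℚ + ½ * 1ℚ                       ≡⟨ ½+½ 1ℚ ⟩
    1ℚ                                    ∎
    where
    open ℚ.≤-Reasoning
    open +-*-Solver

  *½^-null : ∀ C ε → 0ℚ < C → 0ℚ < ε → ∃ λ N → ∀ n → N ℕ.≤ n → C * ½^ n ≤ ε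
  *½^-null C ε 0<C 0<ε with quotient C ε 0<C 0<ε
  ... | q , _ , εq≡C with archimedean q
  ... | N , q≤N = N , λ n N≤n → begin
    C * ½^ n               ≡⟨ cong (_* ½^ n) εq≡C ⟨
    ε * q * ½^ n           ≡⟨ ℚ.*-assoc ε q (½^ n) ⟩
    ε * (q * ½^ n)         ≤⟨ mono (ℚ.*-monoʳ-≤-nonNeg (½^ n) {{nonNegative (½^-nonNeg n)}}
                                (ℚ.≤-trans q≤N (fromℕ-mono N≤n))) ⟩
    ε * (fromℕ n * ½^ n)   ≤⟨ mono (fromℕ*½^-≤1 n) ⟩
    ε * 1ℚ                 ≡⟨ ℚ.*-identityʳ ε ⟩
    ε                      ∎
    where
    open ℚ.≤-Reasoning
    mono : ∀ {a b} → a ≤ b → ε * a ≤ ε * b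
    mono = ℚ.*-monoˡ-≤-nonNeg ε {{nonNegative (ℚ.<⇒≤ 0<ε)}}

  ∣*-*∣-≤ : ∀ {a b c d A D η ε} → 0ℚ ≤ η → ∣ a ∣ ≤ A → ∣ d ∣ ≤ D →
            ∣ a - c ∣ ≤ η → ∣ b - d ∣ ≤ η → (A + D) * η ≡ ε → ∣ a * b - c * d ∣ ≤ ε
  ∣*-*∣-≤ {a} {b} {c} {d} {A} {D} {η} {ε} 0≤η ha hd hac hbd eq = begin
    ∣ a * b - c * d ∣                        ≡⟨ cong ∣_∣ (solve 4 (λ a b c d → a :* b :- c :* d
                                                 := a :* (b :- d) :+ d :* (a :- c)) refl a b c d) ⟩
    ∣ a * (b - d) + d * (a - c) ∣            ≤⟨ ℚ.∣p+q∣≤∣p∣+∣q∣ (a * (b - d)) (d * (a - c)) ⟩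
    ∣ a * (b - d) ∣ + ∣ d * (a - c) ∣        ≡⟨ cong₂ _+_ (ℚ.∣p*q∣≡∣p∣*∣q∣ a (b - d)) (ℚ.∣p*q∣≡∣p∣*∣q∣ d (a - c)) ⟩
    ∣ a ∣ * ∣ b - d ∣ + ∣ d ∣ * ∣ a - c ∣    ≤⟨ ℚ.+-mono-≤ (*-mono-≤ (ℚ.0≤∣p∣ a) 0≤η ha hbd)
                                                           (*-mono-≤ (ℚ.0≤∣p∣ d) 0≤η hd hac) ⟩
    A * η + D * η                            ≡⟨ ℚ.*-distribʳ-+ η A D ⟨
    (A + D) * η                              ≡⟨ eq ⟩
    ε                                        ∎
    where
    open ℚ.≤-Reasoning
    open +-*-Solver

  0⊔-lipschitz : ∀ p q → 0ℚ ⊔ p ≤ (0ℚ ⊔ q) + ∣ p - q ∣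
  0⊔-lipschitz p q with ℚ.≤-total 0ℚ p
  ... | inj₁ 0≤p = subst (_≤ (0ℚ ⊔ q) + ∣ p - q ∣) (sym (ℚ.p≤q⇒p⊔q≡q 0≤p))
    (≤-unshift {p} {0ℚ ⊔ q} (ℚ.≤-trans
      (ℚ.+-monoʳ-≤ p (ℚ.neg-antimono-≤ (ℚ.p≤q⊔p 0ℚ q))) (p≤∣p∣ (p - q))))
  ... | inj₂ p≤0 = subst (_≤ (0ℚ ⊔ q) + ∣ p - q ∣) (sym (ℚ.p≥q⇒p⊔q≡p p≤0))
    (ℚ.+-mono-≤ (ℚ.p≤p⊔q 0ℚ q) (ℚ.0≤∣p∣ (p - q)))

  -- Bisection: if l² ≤ a ≤ (l + w)² then √-step n a w l approximates the
  -- square root of a from below up to an error of at most w / 2ⁿ.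
  √-step : ℕ → (a w l : ℚ) → ℚ
  √-step zero    a w l = l
  √-step (suc n) a w l with (l + ½ * w) * (l + ½ * w) ≤? a
  ... | yes _ = √-step n a (½ * w) (l + ½ * w)
  ... | no  _ = √-step n a (½ * w) l

  √-approx : ℕ → ℚ → ℚ
  √-approx n a = √-step n a (1ℚ + a) 0ℚ

  √-step-correct : ∀ n a w l → 0ℚ ≤ w → 0ℚ ≤ l → l * l ≤ a → a ≤ (l + w) * (l + w) →
    let r = √-step n a w l; δ = w * ½^ n
    in 0ℚ ≤ r × r * r ≤ a × a ≤ (r + δ) * (r + δ)
  √-step-correct zero a w l 0≤w 0≤l lo hi =
    0≤l , lo , subst (λ w → a ≤ (l + w) * (l + w)) (sym (ℚ.*-identityʳ w)) hi
  √-step-correct (suc n) a w l 0≤w 0≤l lo hi with (l + ½ * w) * (l + ½ * w) ≤? a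
  ... | yes p = subst Goal shift
          (√-step-correct n a (½ * w) (l + ½ * w) 0≤½w (ℚ.+-mono-≤ 0≤l 0≤½w) p
            (subst (λ z → a ≤ z * z) halves hi))
    where
    0≤½w = 0≤* 0≤½ 0≤w
    r = √-step n a (½ * w) (l + ½ * w)
    Goal = λ δ → 0ℚ ≤ r × r * r ≤ a × a ≤ (r + δ) * (r + δ)
    open +-*-Solver
    shift = solve 2 (λ w h → con ½ :* w :* h := w :* (con ½ :* h)) refl w (½^ n)
    halves = solve 2 (λ l w → l :+ w := l :+ con ½ :* w :+ con ½ :* w) refl l w
  ... | no ¬p = subst Goal shift
          (√-step-correct n a (½ * w) l (0≤* 0≤½ 0≤w) 0≤l lo (ℚ.<⇒≤ (ℚ.≰⇒> ¬p)))
    where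
    r = √-step n a (½ * w) l
    Goal = λ δ → 0ℚ ≤ r × r * r ≤ a × a ≤ (r + δ) * (r + δ)
    open +-*-Solver
    shift = solve 2 (λ w h → con ½ :* w :* h := w :* (con ½ :* h)) refl w (½^ n)

  √-approx-correct : ∀ n a → 0ℚ ≤ a →
    let r = √-approx n a; δ = (1ℚ + a) * ½^ n
    in 0ℚ ≤ r × r * r ≤ a × a ≤ (r + δ) * (r + δ)
  √-approx-correct n a 0≤a = √-step-correct n a (1ℚ + a) 0ℚ (ℚ.+-mono-≤ 0≤1 0≤a) ℚ.≤-refl
    0≤a (subst₂ _≤_ (ℚ.+-identityʳ a)
      (solve 1 (λ a → a :+ (con 1ℚ :+ (a :+ a :* a)) :=
                      (con 0ℚ :+ (con 1ℚ :+ a)) :* (con 0ℚ :+ (con 1ℚ :+ a))) refl a)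
      (ℚ.+-monoʳ-≤ a (ℚ.+-mono-≤ 0≤1 (ℚ.+-mono-≤ 0≤a (0≤* 0≤a 0≤a)))))
    where open +-*-Solver

  √-compare : ∀ {r s a b δ e} → 0ℚ ≤ s → 0ℚ ≤ δ → 0ℚ ≤ e →
    r * r ≤ a → a ≤ b + e * e → b ≤ (s + δ) * (s + δ) → r ≤ s + (δ + e)
  √-compare {r} {s} {a} {b} {δ} {e} 0≤s 0≤δ 0≤e r²≤a a≤b+e² b≤ = square-cancel
    (ℚ.+-mono-≤ 0≤s (ℚ.+-mono-≤ 0≤δ 0≤e)) (begin
      r * r                                         ≤⟨ r²≤a ⟩
      a                                             ≤⟨ a≤b+e² ⟩
      b + e * e                                     ≤⟨ ℚ.+-monoˡ-≤ (e * e) b≤ ⟩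
      (s + δ) * (s + δ) + e * e                     ≡⟨ ℚ.+-identityʳ _ ⟨
      (s + δ) * (s + δ) + e * e + 0ℚ                ≤⟨ ℚ.+-monoʳ-≤ ((s + δ) * (s + δ) + e * e) (ℚ.+-mono-≤ 0≤t 0≤t) ⟩
      (s + δ) * (s + δ) + e * e + (t + t)           ≡⟨ solve 3 (λ s d e → (s :+ d) :* (s :+ d) :+ e :* e
                                                         :+ ((s :+ d) :* e :+ (s :+ d) :* e)
                                                         := (s :+ (d :+ e)) :* (s :+ (d :+ e))) refl s δ e ⟩
      (s + (δ + e)) * (s + (δ + e))                 ∎)
    where
    open ℚ.≤-Reasoning
    open +-*-Solver
    t = (s + δ) * e
    0≤t = 0≤* (ℚ.+-mono-≤ 0≤s 0≤δ) 0≤e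

-- ℝ is the setoid of Cauchy sequences of rationals modulo null sequences.

IsCauchy : (ℕ → ℚ) → Set
IsCauchy s = ∀ ε → 0ℚ ℚ.< ε → ∃ λ N → ∀ m n → N ℕ.≤ m → N ℕ.≤ n → ℚ.∣ s m ℚ.- s n ∣ ℚ.≤ ε

record ℝ : Set where
  constructor mkℝ
  field
    seq    : ℕ → ℚ
    cauchy : IsCauchy seq

open ℝ public

module Real where
  open import Data.Rational using (_<_; _≤_; ∣_∣)
  open ℚ-Lemmas

  infix  4 _≈_
  infixl 7 _*_
  infixl 6 _+_
  infix  8 -_

  record _≈_ (x y : ℝ) : Set where
    constructor mk≈
    field
      close : ∀ ε → 0ℚ < ε → ∃ λ N → ∀ n → N ℕ.≤ n → ∣ seq x n ℚ.- seq y n ∣ ≤ ε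

  open _≈_ public

  abstract
    const-isCauchy : ∀ q → IsCauchy (λ _ → q)
    const-isCauchy q ε 0<ε = 0 , λ _ _ _ _ →
      subst (λ z → ∣ z ∣ ≤ ε) (sym (ℚ.+-inverseʳ q)) (ℚ.<⇒≤ 0<ε)

  fromℚ : ℚ → ℝ
  fromℚ q = mkℝ (λ _ → q) (const-isCauchy q)

  private
    ∣+∣-≤ : ∀ {a b ε} → ∣ a ∣ ≤ ½ ℚ.* ε → ∣ b ∣ ≤ ½ ℚ.* ε → ∣ a ℚ.+ b ∣ ≤ ε
    ∣+∣-≤ {a} {b} {ε} ha hb = ℚ.≤-trans (ℚ.∣p+q∣≤∣p∣+∣q∣ a b)
      (subst (∣ a ∣ ℚ.+ ∣ b ∣ ≤_) (½+½ ε) (ℚ.+-mono-≤ ha hb))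

    interchange : ∀ a b c d → (a ℚ.+ b) ℚ.- (c ℚ.+ d) ≡ (a ℚ.- c) ℚ.+ (b ℚ.- d)
    interchange = solve 4 (λ a b c d → (a :+ b) :- (c :+ d) := (a :- c) :+ (b :- d)) refl
      where open +-*-Solver

    neg-diff : ∀ a b → ∣ ℚ.- a ℚ.- ℚ.- b ∣ ≡ ∣ a ℚ.- b ∣
    neg-diff a b = trans (cong ∣_∣ (solve 2 (λ a b → :- a :- :- b := b :- a) refl a b)) (∣-∣-sym b a)
      where open +-*-Solver

    ⊔ˡ : ∀ {l m n} → l ℕ.⊔ m ℕ.≤ n → l ℕ.≤ n
    ⊔ˡ {l} {m} = ℕ.m⊔n≤o⇒m≤o l m

    ⊔ʳ : ∀ {l m n} → l ℕ.⊔ m ℕ.≤ n → m ℕ.≤ n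
    ⊔ʳ {l} {m} = ℕ.m⊔n≤o⇒n≤o l m

  bounded : ∀ x → ∃ λ B → 0ℚ < B × ∃ λ N → ∀ n → N ℕ.≤ n → ∣ seq x n ∣ ≤ B
  bounded x with cauchy x 1ℚ (ℚ.positive⁻¹ 1ℚ)
  ... | N , h = ∣ c ∣ ℚ.+ 1ℚ , ℚ.+-mono-≤-< (ℚ.0≤∣p∣ c) (ℚ.positive⁻¹ 1ℚ) , N , λ n N≤n →
    subst (λ z → ∣ z ∣ ≤ ∣ c ∣ ℚ.+ 1ℚ)
      (solve 2 (λ c x → c :+ (x :- c) := x) refl c (seq x n))
      (ℚ.≤-trans (ℚ.∣p+q∣≤∣p∣+∣q∣ c (seq x n ℚ.- c))
        (ℚ.+-monoʳ-≤ ∣ c ∣ (h n N N≤n ℕ.≤-refl)))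
    where
    c = seq x N
    open +-*-Solver

  abstract
    +-isCauchy : ∀ x y → IsCauchy (λ n → seq x n ℚ.+ seq y n)
    +-isCauchy x y ε 0<ε =
      let M , p = cauchy x (½ ℚ.* ε) (0<½* 0<ε)
          N , q = cauchy y (½ ℚ.* ε) (0<½* 0<ε)
      in M ℕ.⊔ N , λ m n M⊔N≤m M⊔N≤n →
        subst (λ z → ∣ z ∣ ≤ ε) (sym (interchange (seq x m) (seq y m) (seq x n) (seq y n)))
          (∣+∣-≤ (p m n (⊔ˡ M⊔N≤m) (⊔ˡ M⊔N≤n)) (q m n (⊔ʳ {M} M⊔N≤m) (⊔ʳ {M} M⊔N≤n)))

  _+_ : ℝ → ℝ → ℝ
  x + y = mkℝ (λ n → seq x n ℚ.+ seq y n) (+-isCauchy x y)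

  abstract
    -‿isCauchy : ∀ x → IsCauchy (λ n → ℚ.- seq x n)
    -‿isCauchy x ε 0<ε =
      let N , p = cauchy x ε 0<ε
      in N , λ m n N≤m N≤n → subst (_≤ ε) (sym (neg-diff (seq x m) (seq x n))) (p m n N≤m N≤n)

  -_ : ℝ → ℝ
  - x = mkℝ (λ n → ℚ.- seq x n) (-‿isCauchy x)

  abstract
    *-isCauchy : ∀ x y → IsCauchy (λ n → seq x n ℚ.* seq y n)
    *-isCauchy x y ε 0<ε =
      let A , 0<A , K , a = bounded x
          D , 0<D , L , d = bounded y
          η , 0<η , eq    = quotient ε (A ℚ.+ D) 0<ε (ℚ.+-mono-< 0<A 0<D)
          M , p           = cauchy x η 0<η
          N , q           = cauchy y η 0<η
      in (K ℕ.⊔ L) ℕ.⊔ (M ℕ.⊔ N) , λ m n ≤m ≤n →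
        ∣*-*∣-≤ {seq x m} {seq y m} {seq x n} {seq y n} (ℚ.<⇒≤ 0<η)
          (a m (⊔ˡ (⊔ˡ ≤m))) (d n (⊔ʳ {K} (⊔ˡ ≤n)))
          (p m n (⊔ˡ (⊔ʳ {K ℕ.⊔ L} ≤m)) (⊔ˡ (⊔ʳ {K ℕ.⊔ L} ≤n)))
          (q m n (⊔ʳ {M} (⊔ʳ {K ℕ.⊔ L} ≤m)) (⊔ʳ {M} (⊔ʳ {K ℕ.⊔ L} ≤n))) eq

  _*_ : ℝ → ℝ → ℝ
  x * y = mkℝ (λ n → seq x n ℚ.* seq y n) (*-isCauchy x y)

  pointwise : ∀ {x y} → (∀ n → seq x n ≡ seq y n) → x ≈ y
  pointwise {x} {y} h = mk≈ λ ε 0<ε → 0 , λ n _ → subst (λ z → ∣ z ∣ ≤ ε)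
    (sym (trans (cong (ℚ._- seq y n) (h n)) (ℚ.+-inverseʳ (seq y n)))) (ℚ.<⇒≤ 0<ε)

  ≈-isEquivalence : IsEquivalence _≈_
  ≈-isEquivalence = record
    { refl  = λ {x} → pointwise λ _ → refl
    ; sym   = λ {x} {y} x≈y → mk≈ λ ε 0<ε → let N , p = close x≈y ε 0<ε in
        N , λ n N≤n → subst (_≤ ε) (∣-∣-sym (seq x n) (seq y n)) (p n N≤n)
    ; trans = λ {x} {y} {z} x≈y y≈z → mk≈ λ ε 0<ε →
        let M , p = close x≈y (½ ℚ.* ε) (0<½* 0<ε)
            N , q = close y≈z (½ ℚ.* ε) (0<½* 0<ε)
        in M ℕ.⊔ N , λ n ≤n → subst (λ z → ∣ z ∣ ≤ ε)
          (telescope (seq x n) (seq y n) (seq z n)) (∣+∣-≤ (p n (⊔ˡ ≤n)) (q n (⊔ʳ {M} ≤n)))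
    }
    where
    telescope : ∀ a b c → (a ℚ.- b) ℚ.+ (b ℚ.- c) ≡ a ℚ.- c
    telescope = solve 3 (λ a b c → (a :- b) :+ (b :- c) := a :- c) refl
      where open +-*-Solver

  +-cong : ∀ {x y u v} → x ≈ y → u ≈ v → x + u ≈ y + v
  +-cong {x} {y} {u} {v} x≈y u≈v = mk≈ λ ε 0<ε →
    let M , p = close x≈y (½ ℚ.* ε) (0<½* 0<ε)
        N , q = close u≈v (½ ℚ.* ε) (0<½* 0<ε)
    in M ℕ.⊔ N , λ n ≤n → subst (λ z → ∣ z ∣ ≤ ε)
      (sym (interchange (seq x n) (seq u n) (seq y n) (seq v n)))
      (∣+∣-≤ (p n (⊔ˡ ≤n)) (q n (⊔ʳ {M} ≤n)))

  -‿cong : ∀ {x y} → x ≈ y → - x ≈ - y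
  -‿cong {x} {y} x≈y = mk≈ λ ε 0<ε → let N , p = close x≈y ε 0<ε in
    N , λ n N≤n → subst (_≤ ε) (sym (neg-diff (seq x n) (seq y n))) (p n N≤n)

  *-cong : ∀ {x y u v} → x ≈ y → u ≈ v → x * u ≈ y * v
  *-cong {x} {y} {u} {v} x≈y u≈v = mk≈ λ ε 0<ε →
    let A , 0<A , K , a = bounded x
        D , 0<D , L , d = bounded v
        η , 0<η , eq    = quotient ε (A ℚ.+ D) 0<ε (ℚ.+-mono-< 0<A 0<D)
        M , p           = close x≈y η 0<η
        N , q           = close u≈v η 0<η
    in (K ℕ.⊔ L) ℕ.⊔ (M ℕ.⊔ N) , λ n ≤n →
      ∣*-*∣-≤ {seq x n} {seq u n} {seq y n} {seq v n} (ℚ.<⇒≤ 0<η)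
        (a n (⊔ˡ (⊔ˡ ≤n))) (d n (⊔ʳ {K} (⊔ˡ ≤n)))
        (p n (⊔ˡ (⊔ʳ {K ℕ.⊔ L} ≤n))) (q n (⊔ʳ {M} (⊔ʳ {K ℕ.⊔ L} ≤n))) eq

  isCommutativeRing : IsCommutativeRing _≈_ _+_ _*_ -_ (fromℚ 0ℚ) (fromℚ 1ℚ)
  isCommutativeRing = record
    { isRing = record
      { +-isAbelianGroup = record
        { isGroup = record
          { isMonoid = record
            { isSemigroup = record
              { isMagma = record
                { isEquivalence = ≈-isEquivalence
                ; ∙-cong = +-cong
                }
              ; assoc = λ x y z → pointwise
                  λ n → ℚ.+-assoc (seq x n) (seq y n) (seq z n)
              }
            ; identity = (λ x → pointwise λ n → ℚ.+-identityˡ (seq x n))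
                       , (λ x → pointwise λ n → ℚ.+-identityʳ (seq x n))
            }
          ; inverse = (λ x → pointwise λ n → ℚ.+-inverseˡ (seq x n))
                    , (λ x → pointwise λ n → ℚ.+-inverseʳ (seq x n))
          ; ⁻¹-cong = -‿cong
          }
        ; comm = λ x y → pointwise λ n → ℚ.+-comm (seq x n) (seq y n)
        }
      ; *-cong = *-cong
      ; *-assoc = λ x y z → pointwise
          λ n → ℚ.*-assoc (seq x n) (seq y n) (seq z n)
      ; *-identity = (λ x → pointwise λ n → ℚ.*-identityˡ (seq x n))
                   , (λ x → pointwise λ n → ℚ.*-identityʳ (seq x n))
      ; distrib = (λ x y z → pointwise
                    λ n → ℚ.*-distribˡ-+ (seq x n) (seq y n) (seq z n))
                , (λ x y z → pointwise
                    λ n → ℚ.*-distribʳ-+ (seq x n) (seq y n) (seq z n))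
      }
    ; *-comm = λ x y → pointwise λ n → ℚ.*-comm (seq x n) (seq y n)
    }

  commutativeRing : CommutativeRing 0ℓ 0ℓ
  commutativeRing = record { isCommutativeRing = isCommutativeRing }

  abstract
    √-isCauchy : ∀ x → IsCauchy (λ n → √-approx n (0ℚ ℚ.⊔ seq x n))
    √-isCauchy x ε 0<ε =
      let e                  = ½ ℚ.* ε
          0<e                = 0<½* 0<ε
          B , 0<B , K , b    = bounded x
          L , small          = *½^-null (1ℚ ℚ.+ B) e (ℚ.+-mono-< (ℚ.positive⁻¹ 1ℚ) 0<B) 0<e
          M , near           = cauchy x (e ℚ.* e) (0<* 0<e 0<e)
          bound              = λ m n ≤m ≤n → √-diff {x} {e} {B} (ℚ.<⇒≤ 0<e) m n
                                 (b n (⊔ˡ {K} (⊔ˡ {K ℕ.⊔ L} ≤n)))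
                                 (small n (⊔ʳ {K} (⊔ˡ {K ℕ.⊔ L} ≤n)))
                                 (near m n (⊔ʳ {K ℕ.⊔ L} ≤m) (⊔ʳ {K ℕ.⊔ L} ≤n))
          r                  = λ n → √-approx n (0ℚ ℚ.⊔ seq x n)
      in (K ℕ.⊔ L) ℕ.⊔ M , λ m n ≤m ≤n →
        subst (∣ r m ℚ.- r n ∣ ≤_) (½+½ ε) (∣-∣-bound
          (≤-shift {r m} {r n} (bound m n ≤m ≤n))
          (subst (_≤ e ℚ.+ e) (solve 2 (λ p q → q :- p := :- (p :- q)) refl (r m) (r n))
            (≤-shift {r n} {r m} (bound n m ≤n ≤m))))
      where
      open +-*-Solver
      √-diff : ∀ {x e B} → 0ℚ ≤ e → ∀ m n → ∣ seq x n ∣ ≤ B →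
        (1ℚ ℚ.+ B) ℚ.* ½^ n ≤ e → ∣ seq x m ℚ.- seq x n ∣ ≤ e ℚ.* e →
        √-approx m (0ℚ ℚ.⊔ seq x m) ≤ √-approx n (0ℚ ℚ.⊔ seq x n) ℚ.+ (e ℚ.+ e)
      √-diff {x} {e} {B} 0≤e m n xn≤B small near =
        let a = 0ℚ ℚ.⊔ seq x m
            b = 0ℚ ℚ.⊔ seq x n
            _ , r²≤a , _       = √-approx-correct m a (ℚ.p≤p⊔q 0ℚ (seq x m))
            0≤s , _ , b≤[s+δ]² = √-approx-correct n b (ℚ.p≤p⊔q 0ℚ (seq x n))
            b≤B : b ≤ B
            b≤B = ℚ.⊔-lub (ℚ.≤-trans (ℚ.0≤∣p∣ (seq x n)) xn≤B) (ℚ.≤-trans (p≤∣p∣ (seq x n)) xn≤B)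
            δ≤e = ℚ.≤-trans (ℚ.*-monoʳ-≤-nonNeg (½^ n) {{ℚ.nonNegative (½^-nonNeg n)}}
                    (ℚ.+-monoʳ-≤ 1ℚ b≤B)) small
            0≤δ = 0≤* (ℚ.+-mono-≤ 0≤1 (ℚ.p≤p⊔q 0ℚ (seq x n))) (½^-nonNeg n)
            s   = √-approx n b
        in ℚ.≤-trans
          (√-compare {√-approx m a} {s} {a} {b} 0≤s 0≤δ 0≤e r²≤a
            (ℚ.≤-trans (0⊔-lipschitz (seq x m) (seq x n)) (ℚ.+-monoʳ-≤ b near)) b≤[s+δ]²)
          (ℚ.+-monoʳ-≤ s (ℚ.+-monoˡ-≤ e δ≤e))

  -- The square root of max(x, 0).
  √_ : ℝ → ℝ
  √ x = mkℝ (λ n → √-approx n (0ℚ ℚ.⊔ seq x n)) (√-isCauchy x)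

  NonNegative : ℝ → Set
  NonNegative x = ∀ ε → 0ℚ < ε → ∃ λ N → ∀ n → N ℕ.≤ n → 0ℚ ≤ seq x n ℚ.+ ε

  √-nonNegative : ∀ x → NonNegative (√ x)
  √-nonNegative x ε 0<ε = 0 , λ n _ → ℚ.+-mono-≤
    (proj₁ (√-approx-correct n (0ℚ ℚ.⊔ seq x n) (ℚ.p≤p⊔q 0ℚ (seq x n)))) (ℚ.<⇒≤ 0<ε)

  √-square : ∀ x → NonNegative x → √ x * √ x ≈ x
  √-square x 0≤x = mk≈ λ ε 0<ε →
    let B , 0<B , K , b = bounded x
        1+B             = 1ℚ ℚ.+ B
        0<1+B           = ℚ.+-mono-< (ℚ.positive⁻¹ 1ℚ) 0<B
        C               = 1+B ℚ.+ 1+B ℚ.+ 1+B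
        0<C             = ℚ.+-mono-< (ℚ.+-mono-< 0<1+B 0<1+B) 0<1+B
        η , 0<η , eq    = quotient ε C 0<ε 0<C
        L , small       = *½^-null 1+B η 0<1+B 0<η
        M , nonneg      = 0≤x ε 0<ε
    in (K ℕ.⊔ L) ℕ.⊔ M , λ n ≤n →
      let upper , lower = √-error {x} (ℚ.<⇒≤ 0<ε) (ℚ.<⇒≤ 0<B) n (b n (⊔ˡ {K} (⊔ˡ {K ℕ.⊔ L} ≤n)))
                            (small n (⊔ʳ {K} (⊔ˡ {K ℕ.⊔ L} ≤n))) eq (nonneg n (⊔ʳ {K ℕ.⊔ L} ≤n))
          r²            = seq (√ x * √ x) n
      in ∣-∣-bound (≤-shift {r²} {seq x n} upper)
           (subst (_≤ ε) (solve 2 (λ p q → q :- p := :- (p :- q)) refl r² (seq x n))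
             (≤-shift {seq x n} {r²} lower))
    where
    open +-*-Solver
    √-error : ∀ {x ε B η} → 0ℚ ≤ ε → 0ℚ ≤ B → ∀ n → ∣ seq x n ∣ ≤ B →
      (1ℚ ℚ.+ B) ℚ.* ½^ n ≤ η → ((1ℚ ℚ.+ B) ℚ.+ (1ℚ ℚ.+ B) ℚ.+ (1ℚ ℚ.+ B)) ℚ.* η ≡ ε →
      0ℚ ≤ seq x n ℚ.+ ε →
      let r² = seq (√ x * √ x) n in r² ≤ seq x n ℚ.+ ε × seq x n ≤ r² ℚ.+ ε
    √-error {x} {ε} {B} {η} 0≤ε 0≤B n xn≤B small eq nonneg = upper , lower
      where
      open ℚ.≤-Reasoning
      p = seq x n
      a = 0ℚ ℚ.⊔ p
      0≤a = ℚ.p≤p⊔q 0ℚ p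
      r = √-approx n a
      w = 1ℚ ℚ.+ B
      δ = (1ℚ ℚ.+ a) ℚ.* ½^ n
      sound = √-approx-correct n a 0≤a
      0≤r = proj₁ sound
      r²≤a = proj₁ (proj₂ sound)
      a≤[r+δ]² = proj₂ (proj₂ sound)
      a≤B : a ≤ B
      a≤B = ℚ.⊔-lub 0≤B (ℚ.≤-trans (p≤∣p∣ p) xn≤B)
      0≤w = ℚ.+-mono-≤ 0≤1 0≤B
      0≤δ = 0≤* (ℚ.+-mono-≤ 0≤1 0≤a) (½^-nonNeg n)
      δ≤w½^n : δ ≤ w ℚ.* ½^ n
      δ≤w½^n = ℚ.*-monoʳ-≤-nonNeg (½^ n) {{ℚ.nonNegative (½^-nonNeg n)}} (ℚ.+-monoʳ-≤ 1ℚ a≤B)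
      δ≤w : δ ≤ w
      δ≤w = ℚ.≤-trans δ≤w½^n (subst (w ℚ.* ½^ n ≤_) (ℚ.*-identityʳ w)
        (ℚ.*-monoˡ-≤-nonNeg w {{ℚ.nonNegative 0≤w}} (½^-≤1 n)))
      δ≤η : δ ≤ η
      δ≤η = ℚ.≤-trans δ≤w½^n small
      r≤w : r ≤ w
      r≤w = square-cancel 0≤w (ℚ.≤-trans r²≤a (ℚ.≤-trans a≤B (subst₂ _≤_ (ℚ.+-identityʳ B)
        (solve 1 (λ b → b :+ (con 1ℚ :+ (b :+ b :* b)) := (con 1ℚ :+ b) :* (con 1ℚ :+ b)) refl B)
        (ℚ.+-monoʳ-≤ B (ℚ.+-mono-≤ 0≤1 (ℚ.+-mono-≤ 0≤B (0≤* 0≤B 0≤B)))))))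

      upper : r ℚ.* r ≤ p ℚ.+ ε
      upper = ℚ.≤-trans r²≤a (ℚ.⊔-lub nonneg
        (subst (_≤ p ℚ.+ ε) (ℚ.+-identityʳ p) (ℚ.+-monoʳ-≤ p 0≤ε)))

      lower : p ≤ r ℚ.* r ℚ.+ ε
      lower = begin
        p                                          ≤⟨ ℚ.p≤q⊔p 0ℚ p ⟩
        a                                          ≤⟨ a≤[r+δ]² ⟩
        (r ℚ.+ δ) ℚ.* (r ℚ.+ δ)                    ≡⟨ solve 2 (λ r d → (r :+ d) :* (r :+ d)
                                                        := r :* r :+ (r :+ r :+ d) :* d) refl r δ ⟩
        r ℚ.* r ℚ.+ (r ℚ.+ r ℚ.+ δ) ℚ.* δ          ≤⟨ ℚ.+-monoʳ-≤ (r ℚ.* r) (*-mono-≤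
                                                        (ℚ.+-mono-≤ (ℚ.+-mono-≤ 0≤r 0≤r) 0≤δ)
                                                        (ℚ.≤-trans 0≤δ δ≤η)
                                                        (ℚ.+-mono-≤ (ℚ.+-mono-≤ r≤w r≤w) δ≤w) δ≤η) ⟩
        r ℚ.* r ℚ.+ (w ℚ.+ w ℚ.+ w) ℚ.* η          ≡⟨ cong (r ℚ.* r ℚ.+_) eq ⟩
        r ℚ.* r ℚ.+ ε                              ∎

record ℂ : Set where
  constructor _+i_
  field
    re im : ℝ

open ℂ public

module Complex where
  private
    module R = CommutativeRing Real.commutativeRing

  infix  4 _≈_
  infixl 7 _*_
  infixl 6 _+_
  infix  8 -_

  record _≈_ (z w : ℂ) : Set where
    constructor _,_
    field
      re-≈ : re z R.≈ re w
      im-≈ : im z R.≈ im w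

  open _≈_ public

  _+_ _*_ : ℂ → ℂ → ℂ
  (a +i b) + (c +i d) = (a R.+ c) +i (b R.+ d)
  (a +i b) * (c +i d) = (a R.* c R.- b R.* d) +i (a R.* d R.+ b R.* c)

  -_ : ℂ → ℂ
  - (a +i b) = (R.- a) +i (R.- b)

  fromℝ : ℝ → ℂ
  fromℝ a = a +i R.0#

  conj : ℂ → ℂ
  conj (a +i b) = a +i (R.- b)

  ∣_∣ : ℂ → ℝ
  ∣ a +i b ∣ = Real.√ (a R.* a R.+ b R.* b)

  *-cong : ∀ {z z′ w w′} → z ≈ z′ → w ≈ w′ → z * w ≈ z′ * w′
  *-cong (a , b) (c , d) = R.+-cong (R.*-cong a c) (R.-‿cong (R.*-cong b d))
                         , R.+-cong (R.*-cong a d) (R.*-cong b c)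

  *-comm : ∀ z w → z * w ≈ w * z
  *-comm (a +i b) (c +i d) =
      R.+-cong (R.*-comm a c) (R.-‿cong (R.*-comm b d))
    , R.trans (R.+-comm (a R.* d) (b R.* c)) (R.+-cong (R.*-comm b c) (R.*-comm a d))

  ≈-isEquivalence : IsEquivalence _≈_
  ≈-isEquivalence = record
    { refl  = R.refl , R.refl
    ; sym   = λ (p , q) → R.sym p , R.sym q
    ; trans = λ (p , q) (p′ , q′) → R.trans p p′ , R.trans q q′
    }

  *-identityˡ : ∀ z → fromℝ R.1# * z ≈ z
  *-identityˡ (a +i b) =
      Real.pointwise (λ n → solve 2 (λ a b → con 1ℚ :* a :- con 0ℚ :* b := a) refl (seq a n) (seq b n))
    , Real.pointwise (λ n → solve 2 (λ a b → con 1ℚ :* b :+ con 0ℚ :* a := b) refl (seq a n) (seq b n))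
    where open +-*-Solver

  *-distribˡ-+ : ∀ z w v → z * (w + v) ≈ z * w + z * v
  *-distribˡ-+ (a +i b) (c +i d) (e +i f) =
      Real.pointwise (λ n → solve 6 (λ a b c d e f →
          a :* (c :+ e) :- b :* (d :+ f) := (a :* c :- b :* d) :+ (a :* e :- b :* f))
        refl (seq a n) (seq b n) (seq c n) (seq d n) (seq e n) (seq f n))
    , Real.pointwise (λ n → solve 6 (λ a b c d e f →
          a :* (d :+ f) :+ b :* (c :+ e) := (a :* d :+ b :* c) :+ (a :* f :+ b :* e))
        refl (seq a n) (seq b n) (seq c n) (seq d n) (seq e n) (seq f n))
    where open +-*-Solver

  *-assoc : ∀ z w v → (z * w) * v ≈ z * (w * v)
  *-assoc (a +i b) (c +i d) (e +i f) =
      Real.pointwise (λ n → solve 6 (λ a b c d e f →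
          (a :* c :- b :* d) :* e :- (a :* d :+ b :* c) :* f :=
          a :* (c :* e :- d :* f) :- b :* (c :* f :+ d :* e))
        refl (seq a n) (seq b n) (seq c n) (seq d n) (seq e n) (seq f n))
    , Real.pointwise (λ n → solve 6 (λ a b c d e f →
          (a :* c :- b :* d) :* f :+ (a :* d :+ b :* c) :* e :=
          a :* (c :* f :+ d :* e) :+ b :* (c :* e :- d :* f))
        refl (seq a n) (seq b n) (seq c n) (seq d n) (seq e n) (seq f n))
    where open +-*-Solver

  isCommutativeRing : IsCommutativeRing _≈_ _+_ _*_ -_ (fromℝ R.0#) (fromℝ R.1#)
  isCommutativeRing = record
    { isRing = record
      { +-isAbelianGroup = record
        { isGroup = record
          { isMonoid = record
            { isSemigroup = record
              { isMagma = record
                { isEquivalence = ≈-isEquivalence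
                ; ∙-cong = λ (p , q) (p′ , q′) → R.+-cong p p′ , R.+-cong q q′
                }
              ; assoc = λ (a +i b) (c +i d) (e +i f) → R.+-assoc a c e , R.+-assoc b d f
              }
            ; identity = (λ (a +i b) → R.+-identityˡ a , R.+-identityˡ b)
                       , (λ (a +i b) → R.+-identityʳ a , R.+-identityʳ b)
            }
          ; inverse = (λ (a +i b) → R.-‿inverseˡ a , R.-‿inverseˡ b)
                    , (λ (a +i b) → R.-‿inverseʳ a , R.-‿inverseʳ b)
          ; ⁻¹-cong = λ (p , q) → R.-‿cong p , R.-‿cong q
          }
        ; comm = λ (a +i b) (c +i d) → R.+-comm a c , R.+-comm b d
        }
      ; *-cong = *-cong
      ; *-assoc = *-assoc
      ; *-identity = *-identityˡ
                   , (λ z → trans′ (*-comm z (fromℝ R.1#)) (*-identityˡ z))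
      ; distrib = *-distribˡ-+
                , (λ z w v → trans′ (*-comm (w + v) z) (trans′ (*-distribˡ-+ z w v)
                    (+-cong′ (*-comm z w) (*-comm z v))))
      }
    ; *-comm = *-comm
    }
    where
    open IsEquivalence ≈-isEquivalence using () renaming (trans to trans′)
    +-cong′ : ∀ {z z′ w w′} → z ≈ z′ → w ≈ w′ → z + w ≈ z′ + w′
    +-cong′ (p , q) (p′ , q′) = R.+-cong p p′ , R.+-cong q q′

  commutativeRing : CommutativeRing 0ℓ 0ℓ
  commutativeRing = record { isCommutativeRing = isCommutativeRing }

-- R[X] is presented as the free commutative R-algebra on the set X of
-- variables: terms modulo the congruence generated by the ring laws and the
-- relations making con a ring homomorphism.

module Polynomials {c ℓ x} (R : CommutativeRing c ℓ) (X : Set x) where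
  private module R = CommutativeRing R

  infix  4 _≈_
  infixl 7 _*_
  infixl 6 _+_
  infix  8 -_

  data Poly : Set (c Level.⊔ x) where
    con     : R.Carrier → Poly
    var     : X → Poly
    _+_ _*_ : Poly → Poly → Poly
    -_      : Poly → Poly

  data _≈_ : Poly → Poly → Set (c Level.⊔ ℓ Level.⊔ x) where
    ≈-refl  : ∀ {f} → f ≈ f
    ≈-sym   : ∀ {f g} → f ≈ g → g ≈ f
    ≈-trans : ∀ {f g h} → f ≈ g → g ≈ h → f ≈ h

    con-cong : ∀ {a b} → a R.≈ b → con a ≈ con b
    +-cong   : ∀ {f f′ g g′} → f ≈ f′ → g ≈ g′ → f + g ≈ f′ + g′
    *-cong   : ∀ {f f′ g g′} → f ≈ f′ → g ≈ g′ → f * g ≈ f′ * g′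
    -‿cong   : ∀ {f f′} → f ≈ f′ → - f ≈ - f′

    con-+ : ∀ a b → con (a R.+ b) ≈ con a + con b
    con-* : ∀ a b → con (a R.* b) ≈ con a * con b

    +-assoc      : ∀ f g h → (f + g) + h ≈ f + (g + h)
    +-comm       : ∀ f g → f + g ≈ g + f
    +-identityʳ  : ∀ f → f + con R.0# ≈ f
    -‿inverseʳ   : ∀ f → f + - f ≈ con R.0#
    *-assoc      : ∀ f g h → (f * g) * h ≈ f * (g * h)
    *-comm       : ∀ f g → f * g ≈ g * f
    *-identityʳ  : ∀ f → f * con R.1# ≈ f
    *-distribˡ-+ : ∀ f g h → f * (g + h) ≈ f * g + f * h

  isCommutativeRing : IsCommutativeRing _≈_ _+_ _*_ -_ (con R.0#) (con R.1#)
  isCommutativeRing = record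
    { isRing = record
      { +-isAbelianGroup = record
        { isGroup = record
          { isMonoid = record
            { isSemigroup = record
              { isMagma = record
                { isEquivalence = record { refl = ≈-refl ; sym = ≈-sym ; trans = ≈-trans }
                ; ∙-cong = +-cong
                }
              ; assoc = +-assoc
              }
            ; identity = (λ f → ≈-trans (+-comm _ f) (+-identityʳ f)) , +-identityʳ
            }
          ; inverse = (λ f → ≈-trans (+-comm _ f) (-‿inverseʳ f)) , -‿inverseʳ
          ; ⁻¹-cong = -‿cong
          }
        ; comm = +-comm
        }
      ; *-cong = *-cong
      ; *-assoc = *-assoc
      ; *-identity = (λ f → ≈-trans (*-comm _ f) (*-identityʳ f)) , *-identityʳ
      ; distrib = *-distribˡ-+
                , (λ f g h → ≈-trans (*-comm _ f) (≈-trans (*-distribˡ-+ f g h)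
                    (+-cong (*-comm f g) (*-comm f h))))
      }
    ; *-comm = *-comm
    }

  commutativeRing : CommutativeRing (c Level.⊔ x) (c Level.⊔ ℓ Level.⊔ x)
  commutativeRing = record { isCommutativeRing = isCommutativeRing }

  -- A is regarded as an R-algebra through ι.
  module _ {a ℓ′} (A : CommutativeRing a ℓ′) (ι : R.Carrier → CommutativeRing.Carrier A) where
    private module A = CommutativeRing A

    eval : (X → A.Carrier) → Poly → A.Carrier
    eval p (con a) = ι a
    eval p (var v) = p v
    eval p (f + g) = eval p f A.+ eval p g
    eval p (f * g) = eval p f A.* eval p g
    eval p (- f)   = A.- eval p f

module Ideals {c ℓ} (R : CommutativeRing c ℓ) where
  open CommutativeRing R using (_≈_; _+_; _*_; 0#; +-commutativeMonoid) renaming (Carrier to A)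
  open Sum +-commutativeMonoid using (sum)

  infixl 6 _+ᴵ_

  data ⟨_⟩ {p} (G : Pred A p) : Pred A (c Level.⊔ ℓ Level.⊔ p) where
    gen   : ∀ {f} → f ∈ G → f ∈ ⟨ G ⟩
    zero∈ : 0# ∈ ⟨ G ⟩
    +∈    : ∀ {f g} → f ∈ ⟨ G ⟩ → g ∈ ⟨ G ⟩ → f + g ∈ ⟨ G ⟩
    *∈    : ∀ r {f} → f ∈ ⟨ G ⟩ → r * f ∈ ⟨ G ⟩
    resp  : ∀ {f g} → f ≈ g → f ∈ ⟨ G ⟩ → g ∈ ⟨ G ⟩

  _+ᴵ_ : ∀ {p q} → Pred A p → Pred A q → Pred A (c Level.⊔ ℓ Level.⊔ p Level.⊔ q)
  (I +ᴵ J) f = ∃ λ g → ∃ λ h → g ∈ I × h ∈ J × f ≈ g + h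

  ∑ᴵ : ∀ {p k} → Vector (Pred A p) k → Pred A (c Level.⊔ ℓ Level.⊔ p)
  ∑ᴵ J f = ∃ λ g → (∀ l → g l ∈ J l) × f ≈ sum g

-- For a family a of vectors, a j i is the i-th coordinate of the j-th vector:
-- the index order is opposite to that of the matrix with columns a j.

Vecℂ : ℕ → Set
Vecℂ n = Vector ℂ n

module _ {n : ℕ} where
  open CommutativeRing Complex.commutativeRing
  open Sum +-commutativeMonoid using (sum-syntax)
  open Complex using (conj; ∣_∣)
  private module R = CommutativeRing Real.commutativeRing

  ⟨_,_⟩ : Vecℂ n → Vecℂ n → ℂ
  ⟨ u , v ⟩ = ∑[ i < n ] (u i * conj (v i))

  LinearlyIndependent : Vector (Vecℂ n) n → Set
  LinearlyIndependent a = ∀ (c : Vector ℂ n) →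
    (∀ i → ∑[ j < n ] (c j * a j i) ≈ 0#) → ∀ j → c j ≈ 0#

  Spanning : Vector (Vecℂ n) n → Set
  Spanning a = ∀ (v : Vecℂ n) → ∃ λ (c : Vector ℂ n) → ∀ i → v i ≈ ∑[ j < n ] (c j * a j i)

  record IsOrthonormalBasis (a : Vector (Vecℂ n) n) : Set where
    field
      linearlyIndependent : LinearlyIndependent a
      spanning            : Spanning a
      normalised          : ∀ j → ⟨ a j , a j ⟩ ≈ 1#
      orthogonal          : ∀ j k → j ≢ k → ⟨ a j , a k ⟩ ≈ 0#

  -- ∣ ⟨ a i , b j ⟩ ∣ = 1 / √n, where r = 1 / s is expressed as r * s = 1.
  MutuallyUnbiased : Vector (Vecℂ n) n → Vector (Vecℂ n) n → Set
  MutuallyUnbiased a b = ∀ i j → ∣ ⟨ a i , b j ⟩ ∣ R.* Real.√ Real.fromℚ (+ n ℚ./ 1) R.≈ R.1#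

  record IsMUBSystem {k : ℕ} (A : Vector (Vector (Vecℂ n) n) k) : Set where
    field
      orthonormalBasis : ∀ l → IsOrthonormalBasis (A l)
      mutuallyUnbiased : ∀ l m → l ≢ m → MutuallyUnbiased (A l) (A m)

data Var (n : ℕ) : Set where
  var-x var-y : Fin n → Fin n → Var n

module Variety (n : ℕ) .{{_ : ℕ.NonZero n}} where
  open Polynomials Real.commutativeRing (Var n) using (Poly; con; eval)
    renaming (commutativeRing to S)
  open CommutativeRing S using (_+_; _*_; _-_; +-commutativeMonoid; semiring)
  open Sum +-commutativeMonoid using (sum-syntax)
  open Exp semiring using (_^_)
  open Ideals S

  private
    X Y : Fin n → Fin n → Poly
    X i j = Polynomials.var (var-x i j)
    Y i j = Polynomials.var (var-y i j)

  data I-generators : Pred Poly 0ℓ where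
    re-part : ∀ j k → j ≢ k →
      ∑[ i < n ] (X i j * X i k + Y i j * Y i k) ∈ I-generators
    im-part : ∀ j k → j ≢ k →
      ∑[ i < n ] (X i k * Y i j - X i j * Y i k) ∈ I-generators

  I : Pred Poly 0ℓ
  I = ⟨ I-generators ⟩

  module _ (a : Vector (Vecℂ n) n) where
    private
      b c : Fin n → Fin n → Poly
      b i q = con (re (a q i))
      c i q = con (im (a q i))

    data J-generators : Pred Poly 0ℓ where
      unbiased : ∀ j q →
          (∑[ i < n ] (X i j * b i q + Y i j * c i q)) ^ 2
        + (∑[ i < n ] (b i q * Y i j - X i j * c i q)) ^ 2
        - con (Real.fromℚ (+ 1 ℚ./ n)) ∈ J-generators

    J : Pred Poly 0ℓ
    J = ⟨ J-generators ⟩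

  M : ∀ {k} → Vector (Vector (Vecℂ n) n) k → Pred Poly 0ℓ
  M A = I +ᴵ ∑ᴵ (λ l → J (A l))

  -- Points have coordinates in ℂ, the algebraic closure of the coefficient field.
  Z : ∀ {p} → Pred Poly p → Pred (Var n → ℂ) p
  Z Φ p = ∀ f → f ∈ Φ → eval Complex.commutativeRing Complex.fromℝ p f C.≈ C.0#
    where module C = CommutativeRing Complex.commutativeRing

  HasRealPoint : ∀ {p} → Pred (Var n → ℂ) p → Set p
  HasRealPoint V = ∃ λ (p : Var n → ℝ) → (Complex.fromℝ ∘ p) ∈ V

{-# OPTIONS --safe #-}

-- A real point of the variety is a family B of vectors that are pairwise
-- orthogonal and satisfy |⟨b,a⟩|² = 1/n for all b in B and all a in A₁, …, A_k.
-- Such a B is automatically an orthonormal basis: Parseval's identity for A₁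
-- gives ‖b‖² = n · 1/n = 1, and each a in A₁ satisfies Bessel's inequality for
-- B with equality, 1 = n · 1/n, so it lies in the span of B.

module Submission where

open import Algebra.Bundles using (CommutativeMonoid; CommutativeRing)
import Algebra.Properties.Group as GroupProperties
import Algebra.Properties.Ring as RingProperties
import Algebra.Properties.CommutativeMonoid.Sum as MonoidSum
import Algebra.Properties.Semiring.Sum as SemiringSum
open import Defs
open import Data.Fin.Base using (Fin; zero; suc; _↑ˡ_; _↑ʳ_; fromℕ<; splitAt)
import Data.Fin.Properties as Fin
open import Data.Integer.Base as ℤ using (+_)
import Data.Integer.Properties as ℤ
open import Data.Nat.Base as ℕ using (ℕ; NonZero)
import Data.Nat.Properties as ℕ
open import Data.Product.Base using (∃; _×_; _,_; proj₁)
open import Data.Rational as ℚ using (ℚ; 0ℚ; 1ℚ)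
import Data.Rational.Properties as ℚ
open import Data.Rational.Solver using (module +-*-Solver)
import Data.Rational.Unnormalised as ℚᵘ
import Data.Rational.Unnormalised.Properties as ℚᵘ
open import Data.Sum.Base using (inj₁; inj₂)
open import Data.Vec.Functional using (Vector; _++_; _∷_; [])
open import Data.Vec.Functional.Properties using (lookup-++ˡ; lookup-++ʳ)
open import Function.Base using (_∘_; id)
open import Function.Bundles using (_⇔_; mk⇔; Equivalence)
open import Relation.Binary.PropositionalEquality as ≡
  using (_≡_; _≢_; cong; subst; subst₂)
import Relation.Binary.Reasoning.Setoid as SetoidReasoning
open import Relation.Nullary.Negation using (contradiction)
open import Relation.Unary using (Pred; _∈_; _⊆_)

private
  module R  = CommutativeRing Real.commutativeRing
  module ∑ᴿ = SemiringSum R.semiring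
  module C  = CommutativeRing Complex.commutativeRing
  module ∑ᶜ = SemiringSum C.semiring

open Complex using (_,_; conj; fromℝ)

-- Finite sums in a commutative monoid.

module _ {a ℓ} (M : CommutativeMonoid a ℓ) where
  open CommutativeMonoid M renaming (_∙_ to _+_; ε to 0#)
  open MonoidSum M

  sum≈0 : ∀ {n} {f : Vector Carrier n} → (∀ i → f i ≈ 0#) → sum f ≈ 0#
  sum≈0 {n} f≈0 = trans (sum-cong-≋ f≈0) (sum-replicate-zero n)

  sum-single : ∀ {n} {f : Vector Carrier n} k → (∀ j → j ≢ k → f j ≈ 0#) → sum f ≈ f k
  sum-single zero    f≈0 = trans (∙-congˡ (sum≈0 (λ j → f≈0 (suc j) λ ()))) (identityʳ _)
  sum-single (suc k) f≈0 = trans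
    (∙-cong (f≈0 zero λ ()) (sum-single k (λ j j≢k → f≈0 (suc j) (j≢k ∘ Fin.suc-injective))))
    (identityˡ _)

-- Nonnegative reals and vanishing sums of squares.

p*p-nonNeg : ∀ p → 0ℚ ℚ.≤ p ℚ.* p
p*p-nonNeg p with ℚ.≤-total 0ℚ p
... | inj₁ 0≤p = ℚ-Lemmas.0≤* 0≤p 0≤p
... | inj₂ p≤0 = subst (0ℚ ℚ.≤_) (solve 1 (λ p → :- p :* :- p := p :* p) ≡.refl p)
                   (ℚ-Lemmas.0≤* (ℚ.neg-antimono-≤ p≤0) (ℚ.neg-antimono-≤ p≤0))
  where open +-*-Solver

∣p-0∣≤⇒p≤ : ∀ {p ε} → ℚ.∣ p ℚ.- 0ℚ ∣ ℚ.≤ ε → p ℚ.≤ ε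
∣p-0∣≤⇒p≤ {p} h = ℚ.≤-trans (ℚ-Lemmas.p≤∣p∣ p) (subst (λ q → ℚ.∣ q ∣ ℚ.≤ _) (ℚ.+-identityʳ p) h)

module _ where
  open Real using (mk≈; close; √_; pointwise)
  open R hiding (zero)

  -- Stronger than Real.NonNegative and not invariant under ≈, but closed under
  -- sums and products termwise and satisfied by all squares and square roots.
  SeqNonNegative : ℝ → Set
  SeqNonNegative x = ∀ n → 0ℚ ℚ.≤ seq x n

  seqNonNegative⇒nonNegative : ∀ {x} → SeqNonNegative x → Real.NonNegative x
  seqNonNegative⇒nonNegative 0≤x ε 0<ε = 0 , λ n _ → ℚ.+-mono-≤ (0≤x n) (ℚ.<⇒≤ 0<ε)

  √-seqNonNegative : ∀ x → SeqNonNegative (√ x)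
  √-seqNonNegative x n = proj₁ (ℚ-Lemmas.√-approx-correct n _ (ℚ.p≤p⊔q 0ℚ (seq x n)))

  sum-seqNonNegative : ∀ {n} {f : Vector ℝ n} → (∀ i → SeqNonNegative (f i)) → SeqNonNegative (∑ᴿ.sum f)
  sum-seqNonNegative {ℕ.zero}  0≤f m = ℚ.≤-refl
  sum-seqNonNegative {ℕ.suc n} 0≤f m = ℚ.+-mono-≤ (0≤f zero m) (sum-seqNonNegative (0≤f ∘ suc) m)

  -- Termwise `0 ≤ p ≤ p + q`, so the index from which `x + y` is within `ε` of zero also serves
  -- `x`.
  +≈0⇒≈0 : ∀ {x y} → SeqNonNegative x → SeqNonNegative y → x + y ≈ 0# → x ≈ 0#
  +≈0⇒≈0 {x} {y} 0≤x 0≤y x+y≈0 = mk≈ λ ε 0<ε →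
    let N , h = close x+y≈0 ε 0<ε
    in N , λ n N≤n → let p = seq x n; q = seq y n in
      subst (ℚ._≤ ε) (≡.sym (≡.trans (cong ℚ.∣_∣ (ℚ.+-identityʳ p)) (ℚ.0≤p⇒∣p∣≡p (0≤x n))))
        (ℚ.≤-trans (subst (ℚ._≤ p ℚ.+ q) (ℚ.+-identityʳ p) (ℚ.+-monoʳ-≤ p (0≤y n)))
          (∣p-0∣≤⇒p≤ (h n N≤n)))

  sum≈0⇒≈0 : ∀ {n} {f : Vector ℝ n} → (∀ i → SeqNonNegative (f i)) → ∑ᴿ.sum f ≈ 0# → ∀ i → f i ≈ 0#
  sum≈0⇒≈0 0≤f ∑f≈0 zero    = +≈0⇒≈0 (0≤f zero) (sum-seqNonNegative (0≤f ∘ suc)) ∑f≈0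
  sum≈0⇒≈0 0≤f ∑f≈0 (suc i) = sum≈0⇒≈0 (0≤f ∘ suc)
    (+≈0⇒≈0 (sum-seqNonNegative (0≤f ∘ suc)) (0≤f zero) (trans (+-comm _ _) ∑f≈0)) i

  x*x≈0⇒x≈0 : ∀ {x} → x * x ≈ 0# → x ≈ 0#
  x*x≈0⇒x≈0 {x} x²≈0 = mk≈ λ ε 0<ε →
    -- Tolerance `ε²` for the square yields tolerance `ε` for `x`: from `p² ≤ ε²` follow both
    -- `p ≤ ε` and `- p ≤ ε`.
    let N , h = close x²≈0 (ε ℚ.* ε) (ℚ-Lemmas.0<* 0<ε 0<ε)
    in N , λ n N≤n →
      let p   = seq x n
          0≤ε = ℚ.<⇒≤ 0<ε
          p²≤ = ∣p-0∣≤⇒p≤ (h n N≤n)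
      in subst (λ q → ℚ.∣ q ∣ ℚ.≤ ε) (≡.sym (ℚ.+-identityʳ p))
        (ℚ-Lemmas.∣-∣-bound (ℚ-Lemmas.square-cancel 0≤ε p²≤)
          (ℚ-Lemmas.square-cancel 0≤ε (subst (ℚ._≤ ε ℚ.* ε)
            (solve 1 (λ p → p :* p := :- p :* :- p) ≡.refl p) p²≤)))
    where open +-*-Solver

  -- (1 - x)² + x (1 - x)² = (1 - x) (1 - x²) is a vanishing sum of nonnegative terms.
  x*x≈1⇒x≈1 : ∀ {x} → SeqNonNegative x → x * x ≈ 1# → x ≈ 1#
  x*x≈1⇒x≈1 {x} 0≤x x²≈1 = sym (x∙y⁻¹≈ε⇒x≈y 1# x (x*x≈0⇒x≈0 (+≈0⇒≈0
    (λ n → p*p-nonNeg (1ℚ ℚ.- seq x n))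
    (λ n → ℚ-Lemmas.0≤* (0≤x n) (p*p-nonNeg (1ℚ ℚ.- seq x n)))
    (begin
      (1# - x) * (1# - x) + x * ((1# - x) * (1# - x)) ≈⟨ pointwise (λ n → solve 1
        (λ p → (con 1ℚ :- p) :* (con 1ℚ :- p) :+ p :* ((con 1ℚ :- p) :* (con 1ℚ :- p))
             := (con 1ℚ :- p) :* (con 1ℚ :- p :* p)) ≡.refl (seq x n)) ⟩
      (1# - x) * (1# - x * x)                         ≈⟨ *-congˡ {1# - x} (+-congˡ {1#} (-‿cong x²≈1)) ⟩
      (1# - x) * (1# - 1#)                            ≈⟨ *-congˡ {1# - x} (-‿inverseʳ 1#) ⟩
      (1# - x) * 0#                                   ≈⟨ zeroʳ (1# - x) ⟩
      0#                                              ∎))))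
    where
    open GroupProperties +-group using (x∙y⁻¹≈ε⇒x≈y)
    open +-*-Solver
    open SetoidReasoning setoid

-- The constant 1/n and the squared form of unbiasedness.

n*1/n≡1 : ∀ n .{{_ : NonZero n}} → (+ n ℚ./ 1) ℚ.* (+ 1 ℚ./ n) ≡ 1ℚ
-- In the unnormalised rationals no reduction by a gcd intervenes, and the claim is a
-- cross-multiplication of integers.
n*1/n≡1 n@(ℕ.suc m) = ℚ.toℚᵘ-injective (ℚᵘ.≃-trans (ℚ.toℚᵘ-homo-* (+ n ℚ./ 1) (+ 1 ℚ./ n))
  (ℚᵘ.≃-trans (ℚᵘ.*-cong (ℚ.toℚᵘ-fromℚᵘ (ℚᵘ.mkℚᵘ (+ n) 0)) (ℚ.toℚᵘ-fromℚᵘ (ℚᵘ.mkℚᵘ (+ 1) m)))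
    (ℚᵘ.*≡* (≡.trans (ℤ.*-identityʳ _) (≡.trans (ℤ.*-comm (+ n) (+ 1))
      (cong (λ i → + 1 ℤ.* + i) (≡.sym (ℕ.*-identityˡ n))))))))

normSq : ℂ → ℝ
normSq (a +i b) = a R.* a R.+ b R.* b

normSq-seqNonNegative : ∀ z → SeqNonNegative (normSq z)
normSq-seqNonNegative (a +i b) n = ℚ.+-mono-≤ (p*p-nonNeg (seq a n)) (p*p-nonNeg (seq b n))

normSq≈0⇒≈0 : ∀ {z} → normSq z R.≈ R.0# → z C.≈ C.0#
normSq≈0⇒≈0 {a +i b} h =
    x*x≈0⇒x≈0 (+≈0⇒≈0 (p*p-nonNeg ∘ seq a) (p*p-nonNeg ∘ seq b) h)
  , x*x≈0⇒x≈0 (+≈0⇒≈0 (p*p-nonNeg ∘ seq b) (p*p-nonNeg ∘ seq a) (R.trans (R.+-comm _ _) h))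

module _ (n : ℕ) .{{_ : NonZero n}} where
  open R hiding (zero)
  open Real using (fromℚ; pointwise; √_; √-square)
  open Complex using (∣_∣)
  open SetoidReasoning setoid

  N 1/N : ℝ
  N   = fromℚ (+ n ℚ./ 1)
  1/N = fromℚ (+ 1 ℚ./ n)

  N*1/N≈1 : N * 1/N ≈ 1#
  N*1/N≈1 = pointwise (λ _ → n*1/n≡1 n)

  [∣z∣*√N]²≈normSq*N : ∀ z → (∣ z ∣ * √ N) * (∣ z ∣ * √ N) ≈ normSq z * N
  [∣z∣*√N]²≈normSq*N z = begin
    (∣ z ∣ * √ N) * (∣ z ∣ * √ N) ≈⟨ pointwise (λ m → solve 2 (λ p q →
      (p :* q) :* (p :* q) := (p :* p) :* (q :* q)) ≡.refl (seq ∣ z ∣ m) (seq (√ N) m)) ⟩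
    (∣ z ∣ * ∣ z ∣) * (√ N * √ N) ≈⟨ *-cong
      (√-square (normSq z) (seqNonNegative⇒nonNegative {normSq z} (normSq-seqNonNegative z)))
      (√-square N (seqNonNegative⇒nonNegative {N} (λ _ → ℚ-Lemmas.fromℕ-nonNeg n))) ⟩
    normSq z * N                  ∎
    where open +-*-Solver

  -- This removes the square roots, leaving the condition that the generators of `J` express.
  -- Forwards, square and multiply by `1/N`. Backwards, the product has square 1 and is termwise
  -- nonnegative, which excludes the root -1.
  ∣z∣*√N≈1⇔normSq≈1/N : ∀ z → ∣ z ∣ * √ N ≈ 1# ⇔ normSq z ≈ 1/N
  ∣z∣*√N≈1⇔normSq≈1/N z = mk⇔
    (λ h → begin
      normSq z                             ≈⟨ *-identityʳ _ ⟨
      normSq z * 1#                        ≈⟨ *-congˡ {normSq z} N*1/N≈1 ⟨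
      normSq z * (N * 1/N)                 ≈⟨ *-assoc (normSq z) N 1/N ⟨
      normSq z * N * 1/N                   ≈⟨ *-congʳ {1/N} ([∣z∣*√N]²≈normSq*N z) ⟨
      (∣ z ∣ * √ N) * (∣ z ∣ * √ N) * 1/N  ≈⟨ *-congʳ {1/N} (*-cong h h) ⟩
      1# * 1# * 1/N                        ≈⟨ *-congʳ {1/N} (*-identityˡ 1#) ⟩
      1# * 1/N                             ≈⟨ *-identityˡ 1/N ⟩
      1/N                                  ∎)
    (λ h → x*x≈1⇒x≈1
      (λ m → ℚ-Lemmas.0≤* (√-seqNonNegative (normSq z) m) (√-seqNonNegative N m))
      (begin
        (∣ z ∣ * √ N) * (∣ z ∣ * √ N) ≈⟨ [∣z∣*√N]²≈normSq*N z ⟩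
        normSq z * N                  ≈⟨ *-congʳ {N} h ⟩
        1/N * N                       ≈⟨ *-comm 1/N N ⟩
        N * 1/N                       ≈⟨ N*1/N≈1 ⟩
        1#                            ∎))

sum-fromℚ : ∀ m q → ∑ᴿ.sum {m} (λ _ → Real.fromℚ q) R.≈ Real.fromℚ (+ m ℚ./ 1) R.* Real.fromℚ q
sum-fromℚ ℕ.zero    q = Real.pointwise (λ _ → ≡.sym (ℚ.*-zeroˡ q))
sum-fromℚ (ℕ.suc m) q = R.trans (R.+-congˡ {Real.fromℚ q} (sum-fromℚ m q)) (Real.pointwise (λ _ → ≡.sym
  (≡.trans (cong (ℚ._* q) (ℚ-Lemmas.fromℕ-suc m))
    (solve 2 (λ m q → (con 1ℚ :+ m) :* q := q :+ m :* q) ≡.refl (+ m ℚ./ 1) q))))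
  where open +-*-Solver

-- Conjugation, real and imaginary parts, and the squared modulus.

conj-cong : ∀ {z w} → z C.≈ w → conj z C.≈ conj w
conj-cong (p , q) = p , R.-‿cong q

conj-sum : ∀ {n} (f : Vector ℂ n) → conj (∑ᶜ.sum f) C.≈ ∑ᶜ.sum (conj ∘ f)
conj-sum {ℕ.zero}  f = R.refl , Real.pointwise (λ _ → ≡.refl)
conj-sum {ℕ.suc n} f = C.trans
  (R.refl , Real.pointwise (λ m → ℚ.neg-distrib-+ (seq (im (f zero)) m) (seq (im (∑ᶜ.sum (f ∘ suc))) m)))
  (C.+-congˡ {conj (f zero)} (conj-sum (f ∘ suc)))

re-sum : ∀ {n} (f : Vector ℂ n) → re (∑ᶜ.sum f) R.≈ ∑ᴿ.sum (re ∘ f)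
re-sum {ℕ.zero}  f = R.refl
re-sum {ℕ.suc n} f = R.+-congˡ {re (f zero)} (re-sum (f ∘ suc))

im-sum : ∀ {n} (f : Vector ℂ n) → im (∑ᶜ.sum f) R.≈ ∑ᴿ.sum (im ∘ f)
im-sum {ℕ.zero}  f = R.refl
im-sum {ℕ.suc n} f = R.+-congˡ {im (f zero)} (im-sum (f ∘ suc))

conj[w*conjz]≈z*conjw : ∀ w z → conj (w C.* conj z) C.≈ z C.* conj w
conj[w*conjz]≈z*conjw (a +i b) (c +i d) =
    Real.pointwise (λ n → solve 4 (λ a b c d →
      a :* c :- b :* :- d := c :* a :- d :* :- b) ≡.refl (seq a n) (seq b n) (seq c n) (seq d n))
  , Real.pointwise (λ n → solve 4 (λ a b c d →
      :- (a :* :- d :+ b :* c) := c :* :- b :+ d :* a) ≡.refl (seq a n) (seq b n) (seq c n) (seq d n))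
  where open +-*-Solver

z*conjz≈normSq : ∀ z → z C.* conj z C.≈ fromℝ (normSq z)
z*conjz≈normSq (a +i b) =
    Real.pointwise (λ n → solve 2 (λ a b →
      a :* a :- b :* :- b := a :* a :+ b :* b) ≡.refl (seq a n) (seq b n))
  , Real.pointwise (λ n → solve 2 (λ a b →
      a :* :- b :+ b :* a := con 0ℚ) ≡.refl (seq a n) (seq b n))
  where open +-*-Solver

normSq-cong : ∀ {z w} → z C.≈ w → normSq z R.≈ normSq w
normSq-cong (p , q) = R.+-cong (R.*-cong p p) (R.*-cong q q)

normSq-conj : ∀ z → normSq (conj z) R.≈ normSq z
normSq-conj (a +i b) = R.+-congˡ {a R.* a}
  (Real.pointwise (λ n → solve 1 (λ b → :- b :* :- b := b :* b) ≡.refl (seq b n)))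
  where open +-*-Solver

-- Inner products and orthonormal expansions.

module _ {n : ℕ} where
  open C hiding (zero)
  open ∑ᶜ
  open SetoidReasoning setoid

  combination : ∀ {m} → Vector ℂ m → Vector (Vecℂ n) m → Vecℂ n
  combination {m} c u i = ∑[ j < m ] (c j * u j i)

  ⟨⟩-congˡ : ∀ {u v} (w : Vecℂ n) → (∀ i → u i ≈ v i) → ⟨ u , w ⟩ ≈ ⟨ v , w ⟩
  ⟨⟩-congˡ w u≈v = sum-cong-≋ (λ i → *-congʳ {conj (w i)} (u≈v i))

  ⟨⟩-conj : (u v : Vecℂ n) → conj ⟨ u , v ⟩ ≈ ⟨ v , u ⟩
  ⟨⟩-conj u v = trans (conj-sum {n} _) (sum-cong-≋ {n} (λ i → conj[w*conjz]≈z*conjw (u i) (v i)))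

  -- Swapping the arguments conjugates the inner product, which leaves the squared modulus fixed.
  -- Hence unbiasedness can be read in either order.
  normSq-⟨⟩-sym : (u v : Vecℂ n) → normSq ⟨ u , v ⟩ R.≈ normSq ⟨ v , u ⟩
  normSq-⟨⟩-sym u v = R.trans (R.sym (normSq-conj ⟨ u , v ⟩)) (normSq-cong (⟨⟩-conj u v))

  ⟨⟩-distribʳ-minus : (u v w : Vecℂ n) → ⟨ (λ i → u i - v i) , w ⟩ ≈ ⟨ u , w ⟩ - ⟨ v , w ⟩
  ⟨⟩-distribʳ-minus u v w = begin
    -- Negation is written as multiplication by -1, so that it leaves the sum as a scalar factor.
    ∑[ i < n ] ((u i - v i) * conj (w i))                       ≈⟨ sum-cong-≋ (λ i → trans
      (distribʳ (conj (w i)) (u i) (- v i))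
      (+-congˡ {u i * conj (w i)} (trans (sym (-‿distribˡ-* (v i) (conj (w i)))) (sym (-1*x≈-x _))))) ⟩
    ∑[ i < n ] (u i * conj (w i) + - 1# * (v i * conj (w i)))   ≈⟨ ∑-distrib-+ {n} _ _ ⟩
    ⟨ u , w ⟩ + ∑[ i < n ] (- 1# * (v i * conj (w i)))          ≈⟨ +-congˡ {⟨ u , w ⟩} (*-distribˡ-sum {n} (- 1#) _) ⟨
    ⟨ u , w ⟩ + - 1# * ⟨ v , w ⟩                                ≈⟨ +-congˡ {⟨ u , w ⟩} (-1*x≈-x ⟨ v , w ⟩) ⟩
    ⟨ u , w ⟩ - ⟨ v , w ⟩                                       ∎
    where open RingProperties ring using (-‿distribˡ-*; -1*x≈-x)

  ⟨combination⟩ : ∀ {m} (c : Vector ℂ m) (u : Vector (Vecℂ n) m) w →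
                  ⟨ combination c u , w ⟩ ≈ ∑[ j < m ] (c j * ⟨ u j , w ⟩)
  ⟨combination⟩ {m} c u w = begin
    ∑[ i < n ] (∑[ j < m ] (c j * u j i) * conj (w i))     ≈⟨ sum-cong-≋ {n} (λ i → trans
      (*-distribʳ-sum {m} (conj (w i)) _) (sum-cong-≋ {m} (λ j → *-assoc (c j) (u j i) (conj (w i))))) ⟩
    ∑[ i < n ] ∑[ j < m ] (c j * (u j i * conj (w i)))     ≈⟨ ∑-comm (λ i j → c j * (u j i * conj (w i))) ⟩
    ∑[ j < m ] ∑[ i < n ] (c j * (u j i * conj (w i)))     ≈⟨ sum-cong-≋ {m} (λ j → *-distribˡ-sum {n} (c j) _) ⟨
    ∑[ j < m ] (c j * ⟨ u j , w ⟩)                         ∎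

  combination-cong : ∀ {m} {c d : Vector ℂ m} (u : Vector (Vecℂ n) m) →
                     (∀ j → c j ≈ d j) → ∀ i → combination c u i ≈ combination d u i
  combination-cong u c≈d i = sum-cong-≋ (λ j → *-congʳ {u j i} (c≈d j))

  -- Exchanging the two sums makes spanning transitive: a combination of vectors that are themselves
  -- expanded in `u` is again expanded in `u`.
  combination-assoc : ∀ {l m} (c : Vector ℂ l) (d : Fin l → Vector ℂ m) (u : Vector (Vecℂ n) m) i →
    combination c (λ q → combination (d q) u) i ≈ combination (λ j → ∑[ q < l ] (c q * d q j)) u i
  combination-assoc {l} {m} c d u i = begin
    ∑[ q < l ] (c q * ∑[ j < m ] (d q j * u j i))          ≈⟨ sum-cong-≋ {l} (λ q → trans
      (*-distribˡ-sum {m} (c q) _) (sum-cong-≋ {m} (λ j → sym (*-assoc (c q) (d q j) (u j i))))) ⟩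
    ∑[ q < l ] ∑[ j < m ] (c q * d q j * u j i)            ≈⟨ ∑-comm (λ q j → c q * d q j * u j i) ⟩
    ∑[ j < m ] ∑[ q < l ] (c q * d q j * u j i)            ≈⟨ sum-cong-≋ {m} (λ j → *-distribʳ-sum {l} (u j i) _) ⟨
    ∑[ j < m ] (∑[ q < l ] (c q * d q j) * u j i)          ∎

  -- The real part of `⟨ v , v ⟩` is the sum of the squared moduli of the coordinates; these are
  -- termwise nonnegative, so each vanishes with the sum.
  ⟨v,v⟩≈0⇒v≈0 : (v : Vecℂ n) → ⟨ v , v ⟩ ≈ 0# → ∀ i → v i ≈ 0#
  ⟨v,v⟩≈0⇒v≈0 v h i = normSq≈0⇒≈0 (sum≈0⇒≈0 (normSq-seqNonNegative ∘ v)
    (R.trans (R.trans (∑ᴿ.sum-cong-≋ {n} (λ j → R.sym (Complex.re-≈ (z*conjz≈normSq (v j))))) (R.sym (re-sum {n} _)))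
      (Complex.re-≈ h)) i)

  -- For orthonormal `u` these are the Fourier coefficients of `v`, and the combination of `u` that
  -- they define is the orthogonal projection of `v` onto the span of `u`.
  coefficients : ∀ {m} → Vector (Vecℂ n) m → Vecℂ n → Vector ℂ m
  coefficients u v j = ⟨ v , u j ⟩

  -- By conjugate symmetry each term is a Fourier coefficient times its own conjugate. The right
  -- side is the Bessel sum, shared by `parseval` and `bessel-equality⇒expansion`.
  ⟨combination-coefficients,v⟩ : ∀ {m} (u : Vector (Vecℂ n) m) v →
    ⟨ combination (coefficients u v) u , v ⟩ ≈ ∑[ j < m ] fromℝ (normSq ⟨ v , u j ⟩)
  ⟨combination-coefficients,v⟩ {m} u v = trans (⟨combination⟩ (coefficients u v) u v)
    (sum-cong-≋ {m} (λ j → trans (*-congˡ {⟨ v , u j ⟩} (sym (⟨⟩-conj v (u j)))) (z*conjz≈normSq ⟨ v , u j ⟩)))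

  module _ {m} {u : Vector (Vecℂ n) m}
           (normalised : ∀ j → ⟨ u j , u j ⟩ ≈ 1#)
           (orthogonal : ∀ j k → j ≢ k → ⟨ u j , u k ⟩ ≈ 0#) where

    ⟨combination,uₖ⟩ : ∀ c k → ⟨ combination c u , u k ⟩ ≈ c k
    ⟨combination,uₖ⟩ c k = begin
      ⟨ combination c u , u k ⟩            ≈⟨ ⟨combination⟩ c u (u k) ⟩
      ∑[ j < m ] (c j * ⟨ u j , u k ⟩)     ≈⟨ sum-single +-commutativeMonoid k
        (λ j j≢k → trans (*-congˡ {c j} (orthogonal j k j≢k)) (zeroʳ (c j))) ⟩
      c k * ⟨ u k , u k ⟩                  ≈⟨ *-congˡ {c k} (normalised k) ⟩
      c k * 1#                             ≈⟨ *-identityʳ (c k) ⟩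
      c k                                  ∎

    -- Pairing the vanishing combination with `u k` isolates `c k`; this is linear independence of
    -- an orthonormal family.
    combination≈0⇒≈0 : ∀ c → (∀ i → combination c u i ≈ 0#) → ∀ k → c k ≈ 0#
    combination≈0⇒≈0 c h k = begin
      c k                          ≈⟨ ⟨combination,uₖ⟩ c k ⟨
      ⟨ combination c u , u k ⟩    ≈⟨ sum≈0 +-commutativeMonoid
        (λ i → trans (*-congʳ {conj (u k i)} (h i)) (zeroˡ (conj (u k i)))) ⟩
      0#                           ∎

    -- Pairing the given expansion with `u j` identifies `c j` as a Fourier coefficient. So `v`
    -- equals its projection, which may replace it in the first slot of `⟨ v , v ⟩`.
    parseval : ∀ v c → (∀ i → v i ≈ combination c u i) →
               ⟨ v , v ⟩ ≈ ∑[ j < m ] fromℝ (normSq ⟨ v , u j ⟩)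
    parseval v c v≈cu = trans
      (⟨⟩-congˡ v (λ i → trans (v≈cu i) (combination-cong u (λ j → sym (trans
        (⟨⟩-congˡ (u j) v≈cu) (⟨combination,uₖ⟩ c j))) i)))
      (⟨combination-coefficients,v⟩ u v)

    -- The residual r of v is orthogonal to every u j, so ⟨r,r⟩ = ⟨v,r⟩, which is
    -- the defect in Bessel's inequality.
    bessel-equality⇒expansion : ∀ v → ⟨ v , v ⟩ ≈ ∑[ j < m ] fromℝ (normSq ⟨ v , u j ⟩) →
                                ∀ i → v i ≈ combination (coefficients u v) u i
    bessel-equality⇒expansion v ⟨v,v⟩≈ i = x∙y⁻¹≈ε⇒x≈y _ _ (⟨v,v⟩≈0⇒v≈0 r ⟨r,r⟩≈0 i)
      where
      open GroupProperties +-group using (x∙y⁻¹≈ε⇒x≈y; x≈y⇒x∙y⁻¹≈ε)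
      c = coefficients u v
      p r : Vecℂ n
      p = combination c u
      r i = v i - p i

      conj0≈0 : conj 0# ≈ 0#
      conj0≈0 = R.refl , Real.pointwise (λ _ → ≡.refl)

      ⟨r,uⱼ⟩≈0 : ∀ j → ⟨ r , u j ⟩ ≈ 0#
      ⟨r,uⱼ⟩≈0 j = trans (⟨⟩-distribʳ-minus v p (u j)) (x≈y⇒x∙y⁻¹≈ε (sym (⟨combination,uₖ⟩ c j)))

      ⟨r,v⟩≈0 : ⟨ r , v ⟩ ≈ 0#
      ⟨r,v⟩≈0 = trans (⟨⟩-distribʳ-minus v p v)
        (x≈y⇒x∙y⁻¹≈ε (trans ⟨v,v⟩≈ (sym (⟨combination-coefficients,v⟩ u v))))

      ⟨x,r⟩≈0 : ∀ x → ⟨ r , x ⟩ ≈ 0# → ⟨ x , r ⟩ ≈ 0#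
      ⟨x,r⟩≈0 x h = trans (sym (⟨⟩-conj r x)) (trans (conj-cong h) conj0≈0)

      ⟨r,r⟩≈0 : ⟨ r , r ⟩ ≈ 0#
      ⟨r,r⟩≈0 = begin
        ⟨ r , r ⟩                ≈⟨ ⟨⟩-distribʳ-minus v p r ⟩
        ⟨ v , r ⟩ - ⟨ p , r ⟩    ≈⟨ x≈y⇒x∙y⁻¹≈ε (trans (⟨x,r⟩≈0 v ⟨r,v⟩≈0) (sym
          (trans (⟨combination⟩ c u r) (sum≈0 +-commutativeMonoid
            (λ j → trans (*-congˡ {c j} (⟨x,r⟩≈0 (u j) (⟨r,uⱼ⟩≈0 j))) (zeroʳ (c j))))))) ⟩
        0#                       ∎

-- Orthogonal families unbiased to an orthonormal basis.

module _ {n : ℕ} .{{_ : NonZero n}} where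
  open C hiding (zero)
  open ∑ᶜ

  ∑1/n≈1 : ∀ {z : Vector ℂ n} → (∀ i → normSq (z i) R.≈ 1/N n) → ∑[ i < n ] fromℝ (normSq (z i)) ≈ 1#
  ∑1/n≈1 h =
      R.trans (re-sum {n} _) (R.trans (∑ᴿ.sum-cong-≋ {n} h)
        (R.trans (sum-fromℚ n (+ 1 ℚ./ n)) (N*1/N≈1 n)))
    , R.trans (im-sum {n} _) (sum≈0 R.+-commutativeMonoid {n} (λ _ → R.refl))

  unbiased⇒isOrthonormalBasis : ∀ {a b : Vector (Vecℂ n) n} → IsOrthonormalBasis a →
    (∀ j k → j ≢ k → ⟨ b j , b k ⟩ ≈ 0#) →
    (∀ j q → normSq ⟨ b j , a q ⟩ R.≈ 1/N n) → IsOrthonormalBasis b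
  unbiased⇒isOrthonormalBasis {a} {b} a-isONB orthogonal unbiased = record
    { linearlyIndependent = combination≈0⇒≈0 normalised orthogonal
    -- Expand `v` in `a`, then each `a q` in `b`; the omitted coefficients are those produced by
    -- `combination-assoc`.
    ; spanning            = λ v → let d , v≈da = A.spanning v in _ , λ i → trans (v≈da i) (trans
        (sum-cong-≋ (λ q → *-congˡ {d q} (expansion q i)))
        (combination-assoc d (λ q → coefficients b (a q)) b i))
    ; normalised          = normalised
    ; orthogonal          = orthogonal
    }
    where
    module A = IsOrthonormalBasis a-isONB
    normalised : ∀ j → ⟨ b j , b j ⟩ ≈ 1#
    normalised j = let c , bⱼ≈ca = A.spanning (b j) in
      trans (parseval A.normalised A.orthogonal (b j) c bⱼ≈ca) (∑1/n≈1 (unbiased j))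
    expansion : ∀ q i → a q i ≈ combination (coefficients b (a q)) b i
    expansion q = bessel-equality⇒expansion normalised orthogonal (a q)
      (trans (A.normalised q) (sym (∑1/n≈1 (λ j → R.trans (normSq-⟨⟩-sym (a q) (b j)) (unbiased j q)))))

-- Evaluation of polynomials and membership in ideals.

module _ {c ℓ x} (A : CommutativeRing c ℓ) {X : Set x} where
  private module A = CommutativeRing A
  open Polynomials A X using (Poly; _≈_; con; var; eval)
    renaming (commutativeRing to A[X])
  open Polynomials._≈_
  private
    module A[X] = CommutativeRing A[X]
    module ∑ᴬ = MonoidSum A.+-commutativeMonoid
    module ∑ᴾ = MonoidSum A[X].+-commutativeMonoid
  open Ideals A[X]

  module _ (p : X → A.Carrier) where

    evaluate : Poly → A.Carrier
    evaluate = eval A id p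

    -- Evaluation is well defined on polynomials because every rule generating `≈` becomes a law of
    -- `A`.
    evaluate-cong : ∀ {f g} → f ≈ g → evaluate f A.≈ evaluate g
    evaluate-cong ≈-refl               = A.refl
    evaluate-cong (≈-sym h)            = A.sym (evaluate-cong h)
    evaluate-cong (≈-trans h h′)       = A.trans (evaluate-cong h) (evaluate-cong h′)
    evaluate-cong (con-cong h)         = h
    evaluate-cong (+-cong h h′)        = A.+-cong (evaluate-cong h) (evaluate-cong h′)
    evaluate-cong (*-cong h h′)        = A.*-cong (evaluate-cong h) (evaluate-cong h′)
    evaluate-cong (-‿cong h)           = A.-‿cong (evaluate-cong h)
    evaluate-cong (con-+ a b)          = A.refl
    evaluate-cong (con-* a b)          = A.refl
    evaluate-cong (+-assoc f g h)      = A.+-assoc _ _ _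
    evaluate-cong (+-comm f g)         = A.+-comm _ _
    evaluate-cong (+-identityʳ f)      = A.+-identityʳ _
    evaluate-cong (-‿inverseʳ f)       = A.-‿inverseʳ _
    evaluate-cong (*-assoc f g h)      = A.*-assoc _ _ _
    evaluate-cong (*-comm f g)         = A.*-comm _ _
    evaluate-cong (*-identityʳ f)      = A.*-identityʳ _
    evaluate-cong (*-distribˡ-+ f g h) = A.distribˡ _ _ _

    evaluate-sum : ∀ {n} (f : Vector Poly n) → evaluate (∑ᴾ.sum f) A.≈ ∑ᴬ.sum (evaluate ∘ f)
    evaluate-sum {ℕ.zero}  f = A.refl
    evaluate-sum {ℕ.suc n} f = A.+-congˡ (evaluate-sum (f ∘ suc))

    -- The kernel of evaluation at `p`. As it is an ideal, checking generators or summands suffices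
    -- for the ideals built from them.
    Vanishes : Pred Poly ℓ
    Vanishes f = evaluate f A.≈ A.0#

    ⟨⟩-vanishes : ∀ {g} {G : Pred Poly g} → G ⊆ Vanishes → ⟨ G ⟩ ⊆ Vanishes
    ⟨⟩-vanishes h (gen f∈G)    = h f∈G
    ⟨⟩-vanishes h zero∈        = A.refl
    ⟨⟩-vanishes h (+∈ f∈ g∈)   = A.trans (A.+-cong (⟨⟩-vanishes h f∈) (⟨⟩-vanishes h g∈)) (A.+-identityʳ _)
    ⟨⟩-vanishes h (*∈ r f∈)    = A.trans (A.*-congˡ (⟨⟩-vanishes h f∈)) (A.zeroʳ _)
    ⟨⟩-vanishes h (resp f≈g f∈) = A.trans (A.sym (evaluate-cong f≈g)) (⟨⟩-vanishes h f∈)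

    +ᴵ-vanishes : ∀ {i j} {I : Pred Poly i} {J : Pred Poly j} →
                  I ⊆ Vanishes → J ⊆ Vanishes → (I +ᴵ J) ⊆ Vanishes
    +ᴵ-vanishes hI hJ (g , h , g∈I , h∈J , f≈g+h) = A.trans (evaluate-cong f≈g+h)
      (A.trans (A.+-cong (hI g∈I) (hJ h∈J)) (A.+-identityʳ _))

    ∑ᴵ-vanishes : ∀ {j k} {J : Vector (Pred Poly j) k} → (∀ l → J l ⊆ Vanishes) → ∑ᴵ J ⊆ Vanishes
    ∑ᴵ-vanishes hJ (g , g∈J , f≈∑g) = A.trans (evaluate-cong f≈∑g)
      (A.trans (evaluate-sum g) (sum≈0 A.+-commutativeMonoid (λ l → hJ l (g∈J l))))

module _ {c ℓ} (R : CommutativeRing c ℓ) where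
  open CommutativeRing R hiding (zero)
  open Ideals R
  open MonoidSum +-commutativeMonoid using (sum)

  ∑ᴵ-zero : ∀ {j k} (J : Vector (Pred Carrier j) k) → (∀ l → 0# ∈ J l) → 0# ∈ ∑ᴵ J
  ∑ᴵ-zero {k = k} J 0∈J = (λ _ → 0#) , 0∈J , sym (sum≈0 +-commutativeMonoid {k} (λ _ → refl))

  -- The witnessing family has the given element at position `l` and zero everywhere else.
  ∑ᴵ-member : ∀ {j k} (J : Vector (Pred Carrier j) k) → (∀ l → 0# ∈ J l) → ∀ l → J l ⊆ ∑ᴵ J
  ∑ᴵ-member J 0∈J zero {f} f∈J = let g , g∈J , 0≈∑g = ∑ᴵ-zero (J ∘ suc) (0∈J ∘ suc) in
    f ∷ g , (λ { zero → f∈J ; (suc l) → g∈J l }) , trans (sym (+-identityʳ f)) (+-congˡ 0≈∑g)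
  ∑ᴵ-member J 0∈J (suc l) f∈J = let g , g∈J , f≈∑g = ∑ᴵ-member (J ∘ suc) (0∈J ∘ suc) l f∈J in
    0# ∷ g , (λ { zero → 0∈J zero ; (suc l) → g∈J l }) , trans f≈∑g (sym (+-identityˡ (sum g)))

-- Real points of the variety.

module _ {x} {X : Set x} (p : X → ℝ) where
  open Polynomials Real.commutativeRing X
    using (Poly; con; var; _+_; _*_; -_; eval)

  -- Since `fromℝ` respects the ring operations, membership of a real point in `Z` reduces to
  -- equations over the reals.
  eval-fromℝ : ∀ f → eval Complex.commutativeRing fromℝ (fromℝ ∘ p) f
                     C.≈ fromℝ (evaluate Real.commutativeRing p f)
  eval-fromℝ (con a) = C.refl
  eval-fromℝ (var v) = C.refl
  eval-fromℝ (f + g) = C.trans (C.+-cong (eval-fromℝ f) (eval-fromℝ g)) (R.refl , R.+-identityʳ R.0#)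
  eval-fromℝ (f * g) = C.trans (C.*-cong (eval-fromℝ f) (eval-fromℝ g))
    ( Real.pointwise (λ n → solve 2 (λ a b → a :* b :- con 0ℚ :* con 0ℚ := a :* b) ≡.refl (seq ⟦ f ⟧ n) (seq ⟦ g ⟧ n))
    , Real.pointwise (λ n → solve 2 (λ a b → a :* con 0ℚ :+ con 0ℚ :* b := con 0ℚ) ≡.refl (seq ⟦ f ⟧ n) (seq ⟦ g ⟧ n)) )
    where
    open +-*-Solver hiding (⟦_⟧)
    ⟦_⟧ = evaluate Real.commutativeRing p
  eval-fromℝ (- f)   = C.trans (C.-‿cong (eval-fromℝ f)) (R.refl , Real.pointwise (λ _ → ≡.refl))

module _ (n : ℕ) .{{_ : NonZero n}} (p : Var n → ℝ) where
  open Variety n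
  open R hiding (zero)
  private
    S = Polynomials.commutativeRing Real.commutativeRing (Var n)
    module S = CommutativeRing S
    ⟦_⟧ = evaluate Real.commutativeRing p
  open Ideals S using (∑ᴵ; zero∈; gen)

  -- The columns of the complex matrix with entries `x_ij + i y_ij`; the indices swap because a
  -- family takes the vector index first.
  basisOf : Vector (Vecℂ n) n
  basisOf j i = p (var-x i j) +i p (var-y i j)

  -- The two generators for a pair `j ≢ k` are the real and imaginary parts of one inner product.
  -- Matching on the membership proof recovers the pair, which the polynomial alone does not expose.
  I-value : ∀ {f} → f ∈ I-generators → ℝ
  I-value (re-part j k _) = re ⟨ basisOf j , basisOf k ⟩
  I-value (im-part j k _) = im ⟨ basisOf j , basisOf k ⟩

  evaluate-I : ∀ {f} (f∈ : f ∈ I-generators) → ⟦ f ⟧ ≈ I-value f∈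
  evaluate-I (re-part j k _) = trans (evaluate-sum Real.commutativeRing p {n} _) (trans
    (∑ᴿ.sum-cong-≋ {n} (λ i → Real.pointwise (λ m → solve 4 (λ xj yj xk yk →
      xj :* xk :+ yj :* yk := xj :* xk :- yj :* :- yk) ≡.refl
        (seq (p (var-x i j)) m) (seq (p (var-y i j)) m) (seq (p (var-x i k)) m) (seq (p (var-y i k)) m))))
    (sym (re-sum {n} _)))
    where open +-*-Solver
  evaluate-I (im-part j k _) = trans (evaluate-sum Real.commutativeRing p {n} _) (trans
    (∑ᴿ.sum-cong-≋ {n} (λ i → Real.pointwise (λ m → solve 4 (λ xj yj xk yk →
      xk :* yj :- xj :* yk := xj :* :- yk :+ yj :* xk) ≡.refl
        (seq (p (var-x i j)) m) (seq (p (var-y i j)) m) (seq (p (var-x i k)) m) (seq (p (var-y i k)) m))))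
    (sym (im-sum {n} _)))
    where open +-*-Solver

  -- The two squared sums in a generator are the squares of the real and imaginary parts of
  -- `⟨ basisOf j , a q ⟩`.
  J-value : ∀ {a f} → f ∈ J-generators a → ℝ
  J-value {a} (unbiased j q) = normSq ⟨ basisOf j , a q ⟩ - 1/N n

  evaluate-J : ∀ {a f} (f∈ : f ∈ J-generators a) → ⟦ f ⟧ ≈ J-value f∈
  evaluate-J {a} (unbiased j q) = +-congʳ { - 1/N n} (+-cong
    (square (trans (evaluate-sum Real.commutativeRing p {n} _) (trans
      (∑ᴿ.sum-cong-≋ {n} (λ i → Real.pointwise (λ m → solve 4 (λ x y b c →
        x :* b :+ y :* c := x :* b :- y :* :- c) ≡.refl
          (seq (p (var-x i j)) m) (seq (p (var-y i j)) m) (seq (re (a q i)) m) (seq (im (a q i)) m))))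
      (sym (re-sum {n} _)))))
    (square (trans (evaluate-sum Real.commutativeRing p {n} _) (trans
      (∑ᴿ.sum-cong-≋ {n} (λ i → Real.pointwise (λ m → solve 4 (λ x y b c →
        b :* y :- x :* c := x :* :- c :+ y :* b) ≡.refl
          (seq (p (var-x i j)) m) (seq (p (var-y i j)) m) (seq (re (a q i)) m) (seq (im (a q i)) m))))
      (sym (im-sum {n} _))))))
    where
    open +-*-Solver
    -- The exponent 2 in the generators unfolds to `s * (s * 1#)`.
    square : ∀ {s t} → s ≈ t → s * (s * 1#) ≈ t * t
    square {s} s≈t = trans (*-congˡ {s} (*-identityʳ s)) (*-cong s≈t s≈t)

  module _ {k} (A : Vector (Vector (Vecℂ n) n) k) where

    module _ (orthogonal : ∀ j k → j ≢ k → ⟨ basisOf j , basisOf k ⟩ C.≈ C.0#)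
             (unbiased′ : ∀ l j q → normSq ⟨ basisOf j , A l q ⟩ ≈ 1/N n) where

      isRealPoint : (fromℝ ∘ p) ∈ Z (M A)
      isRealPoint f f∈M = C.trans (eval-fromℝ p f) (f-vanishes , refl)
        where
        I-vanishes : ∀ {f} (f∈ : f ∈ I-generators) → I-value f∈ ≈ 0#
        I-vanishes (re-part j k j≢k) = Complex.re-≈ (orthogonal j k j≢k)
        I-vanishes (im-part j k j≢k) = Complex.im-≈ (orthogonal j k j≢k)
        J-vanishes : ∀ l {f} (f∈ : f ∈ J-generators (A l)) → J-value f∈ ≈ 0#
        J-vanishes l (unbiased j q) = trans (+-congʳ { - 1/N n} (unbiased′ l j q)) (-‿inverseʳ (1/N n))
        f-vanishes : ⟦ f ⟧ ≈ 0#
        f-vanishes = +ᴵ-vanishes Real.commutativeRing p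
          (⟨⟩-vanishes Real.commutativeRing p (λ f∈ → trans (evaluate-I f∈) (I-vanishes f∈)))
          (∑ᴵ-vanishes Real.commutativeRing p {J = J ∘ A} λ l {g} →
            ⟨⟩-vanishes Real.commutativeRing p (λ f∈ → trans (evaluate-J f∈) (J-vanishes l f∈)) {g})
          {f} f∈M

    module _ (p∈Z : (fromℝ ∘ p) ∈ Z (M A)) where

      evaluate≈0 : ∀ {f} → f ∈ M A → ⟦ f ⟧ ≈ 0#
      evaluate≈0 {f} f∈M = Complex.re-≈ (C.trans (C.sym (eval-fromℝ p f)) (p∈Z f f∈M))

      -- A generator of `I` lies in `M A` with zero as its component in the sum of the `J (A l)`, so
      -- it vanishes at `p`.
      I-value≈0 : ∀ {f} (f∈ : f ∈ I-generators) → I-value f∈ ≈ 0#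
      I-value≈0 {f} f∈ = trans (sym (evaluate-I f∈)) (evaluate≈0
        (f , S.0# , gen f∈ , ∑ᴵ-zero S (J ∘ A) (λ _ → zero∈) , S.sym (S.+-identityʳ f)))

      J-value≈0 : ∀ l {f} (f∈ : f ∈ J-generators (A l)) → J-value f∈ ≈ 0#
      J-value≈0 l {f} f∈ = trans (sym (evaluate-J f∈)) (evaluate≈0
        (S.0# , f , zero∈ , ∑ᴵ-member S (J ∘ A) (λ _ → zero∈) l (gen f∈) , S.sym (S.+-identityˡ f)))

      basisOf-orthogonal : ∀ j k → j ≢ k → ⟨ basisOf j , basisOf k ⟩ C.≈ C.0#
      basisOf-orthogonal j k j≢k = I-value≈0 (re-part j k j≢k) , I-value≈0 (im-part j k j≢k)

      basisOf-unbiased : ∀ l j q → normSq ⟨ basisOf j , A l q ⟩ ≈ 1/N n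
      basisOf-unbiased l j q = x∙y⁻¹≈ε⇒x≈y _ _ (J-value≈0 l (unbiased j q))
        where open GroupProperties +-group using (x∙y⁻¹≈ε⇒x≈y)

-- Inverse to `basisOf`: by eta, `basisOf n (coordinates B)` is `B` definitionally, so facts about
-- `B` apply to this point directly.
coordinates : ∀ {n} → Vector (Vecℂ n) n → Var n → ℝ
coordinates B (var-x i j) = re (B j i)
coordinates B (var-y i j) = im (B j i)

-- Mutual unbiasedness and one-step extensions.

mutuallyUnbiased⇔ : ∀ {n} .{{_ : NonZero n}} (a b : Vector (Vecℂ n) n) →
  MutuallyUnbiased a b ⇔ (∀ i j → normSq ⟨ a i , b j ⟩ R.≈ 1/N n)
mutuallyUnbiased⇔ {n} a b = mk⇔
  (λ h i j → Equivalence.to   (∣z∣*√N≈1⇔normSq≈1/N n ⟨ a i , b j ⟩) (h i j))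
  (λ h i j → Equivalence.from (∣z∣*√N≈1⇔normSq≈1/N n ⟨ a i , b j ⟩) (h i j))

mutuallyUnbiased-sym : ∀ {n} .{{_ : NonZero n}} {a b : Vector (Vecℂ n) n} →
  MutuallyUnbiased a b → MutuallyUnbiased b a
mutuallyUnbiased-sym {a = a} {b} h = Equivalence.from (mutuallyUnbiased⇔ b a) (λ i j →
  R.trans (normSq-⟨⟩-sym (b i) (a j)) (Equivalence.to (mutuallyUnbiased⇔ a b) h j i))

module _ {n k : ℕ} .{{_ : NonZero n}} {A : Vector (Vector (Vecℂ n) n) k} {B : Vector (Vecℂ n) n} where

  extend : IsMUBSystem A → IsOrthonormalBasis B → (∀ l → MutuallyUnbiased (A l) B) →
           IsMUBSystem (A ++ (B ∷ []))
  extend A-isMUB B-isONB A⊥B = record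
    { orthonormalBasis = isONB
    ; mutuallyUnbiased = isUnbiased
    }
    where
    open IsMUBSystem A-isMUB
    isONB : ∀ l → IsOrthonormalBasis ((A ++ (B ∷ [])) l)
    isONB l with splitAt k l
    ... | inj₁ l′   = orthonormalBasis l′
    ... | inj₂ zero = B-isONB
    isUnbiased : ∀ l m → l ≢ m → MutuallyUnbiased ((A ++ (B ∷ [])) l) ((A ++ (B ∷ [])) m)
    -- Inverting the recorded `splitAt` equations carries `l ≢ m` over to the blocks: two old
    -- indices are distinct, and two new ones would coincide.
    isUnbiased l m l≢m with splitAt k l in l-eq | splitAt k m in m-eq
    ... | inj₁ l′   | inj₁ m′   = mutuallyUnbiased l′ m′ λ l′≡m′ → l≢m (≡.trans
      (≡.sym (Fin.splitAt⁻¹-↑ˡ l-eq)) (≡.trans (cong (_↑ˡ 1) l′≡m′) (Fin.splitAt⁻¹-↑ˡ m-eq)))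
    ... | inj₁ l′   | inj₂ zero = A⊥B l′
    ... | inj₂ zero | inj₁ m′   = mutuallyUnbiased-sym {a = A m′} {B} (A⊥B m′)
    ... | inj₂ zero | inj₂ zero = contradiction
      (≡.trans (≡.sym (Fin.splitAt⁻¹-↑ʳ l-eq)) (Fin.splitAt⁻¹-↑ʳ m-eq)) l≢m

  last-unbiased : IsMUBSystem (A ++ (B ∷ [])) → ∀ l → MutuallyUnbiased (A l) B
  last-unbiased A++B l = subst₂ MutuallyUnbiased (lookup-++ˡ A (B ∷ []) l) (lookup-++ʳ A (B ∷ []) zero)
    (IsMUBSystem.mutuallyUnbiased A++B (l ↑ˡ 1) (k ↑ʳ zero) λ eq →
      -- The two positions differ because `splitAt` sends them to different summands.
      contradiction (≡.trans (≡.sym (Fin.splitAt-↑ˡ k l 1)) (≡.trans (cong (splitAt k) eq) (Fin.splitAt-↑ʳ k 1 zero)))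
        λ ())

theorem3 : (n k : ℕ) .{{_ : NonZero n}} .{{_ : NonZero k}}
    (A : Vector (Vector (Vecℂ n) n) k) → IsMUBSystem A →
    (∃ λ (B : Vector (Vecℂ n) n) → IsOrthonormalBasis B × IsMUBSystem (A ++ (B ∷ [])))
    ⇔ Variety.HasRealPoint n (Variety.Z n (Variety.M n A))
theorem3 n k A A-isMUB = mk⇔
  (λ (B , B-isONB , A++B-isMUB) → coordinates B , isRealPoint n (coordinates B) A
    (IsOrthonormalBasis.orthogonal B-isONB)
    -- The generators of `J` take the new vector in the first slot, whereas `last-unbiased` has it
    -- in the second.
    (λ l j q → R.trans (normSq-⟨⟩-sym (B j) (A l q))
      (Equivalence.to (mutuallyUnbiased⇔ (A l) B) (last-unbiased {B = B} A++B-isMUB l) q j)))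
  (λ (p , p∈Z) →
    let B        = basisOf n p
        unbiased = basisOf-unbiased n p A p∈Z
        -- Positivity of `k` provides the first basis of the system, to which Parseval and Bessel
        -- are applied.
        B-isONB  = unbiased⇒isOrthonormalBasis {b = B} (orthonormalBasis (fromℕ< (ℕ.>-nonZero⁻¹ k)))
                     (basisOf-orthogonal n p A p∈Z) (unbiased (fromℕ< (ℕ.>-nonZero⁻¹ k)))
    in B , B-isONB , extend A-isMUB B-isONB (λ l →
         mutuallyUnbiased-sym {a = B} {A l} (Equivalence.from (mutuallyUnbiased⇔ B (A l)) (unbiased l))))
  where open IsMUBSystem A-isMUB
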